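{- Let $n < 8$. Let $\phi$ and $\psi$ be constant-free, negation-free linear formulae on the same set of $n$ variables, and suppose $\phi \to \psi$ is a non-trivial linear inference. Then $\phi$ is $\{\mathsf{s},\mathsf{m}\}$-derivable to $\psi$ without units, i.e. $\phi \overset{*}{\rightsquigarrow}_{\{\mathsf{s},\mathsf{m}\}} \psi$.
   Context: Fix a countably infinite set of variables. Linear formulae on a finite set $\mathcal{V}$ of variables are defined inductively: - $\top$ and $\bot$ are linear formulae on $\emptyset$. - $x$ and $\neg x$ are linear formulae on $\{x\}$. - If $\phi$ is on $\mathcal{V}_1$, $\psi$ is on $\mathcal{V}_2$ and $\mathcal{V}_1\cap\mathcal{V}_2=\emptyset$, then $\phi\lor\psi$ and $\phi\land\psi$ are on $\mathcal{V}_1\cup\mathcal{V}_2$. A formula is constant-free if it contains no $\top,\bot$, and negation-free if it contains no $\neg x$. Formulae are evaluated under Boolean assignments as usual. A linear inference $\phi\to\psi$ is a pair of linear formulae such that every assignment satisfying $\phi$ satisfies $\psi$. An inference $\phi\to\psi$ is trivial at a variable $x$ if $\phi[\top/x]\to\psi[\bot/x]$ is again a valid inference. It is trivial if it is trivial at one of its variables, and non-trivial otherwise. $\sim_{\mathsf{ac}}$ is the smallest equivalence relation on formulae, closed under $\land$- and $\lor$-contexts, containing commutativity and associativity of $\land$ and $\lor$. For a set $S$ of linear inferences, $\to_S$ is the smallest relation containing $S$ and closed under substitution (of linear formulae for variables, keeping linearity) and contexts. We write $\phi\rightsquigarrow_S\psi$ if $\phi\sim_{\mathsf{ac}}\phi'\to_S\psi'\sim_{\mathsf{ac}}\psi$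 for some $\phi',\psi'$, and $\overset{*}{\rightsquigarrow}_S$ for the reflexive-transitive closure of $\rightsquigarrow_S\cup\sim_{\mathsf{ac}}$ ($S$-derivability without units). Switch $\mathsf{s}$ is $x\land(y\lor z)\to(x\land y)\lor z$; medial $\mathsf{m}$ is $(w\land x)\lor(y\land z)\to(w\lor y)\land(x\lor z)$. -}

module Defs where

open import Data.Bool.Base as Bool using (Bool; true; false; if_then_else_)
open import Data.List.Base using (List; []; _∷_; _++_)
open import Data.List.Membership.Propositional using (_∈_)
open import Data.List.Relation.Binary.Permutation.Propositional using (_↭_; ↭-refl)
open import Data.Nat.Base using (ℕ)
open import Data.Nat.Properties using (_≟_)
open import Data.List.Relation.Binary.Disjoint.DecPropositional _≟_
  using (Disjoint; disjoint?)
open import Data.Product.Base using (∃₂; ∃-syntax; _×_; _,_)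
open import Level using (0ℓ)
open import Relation.Binary.Construct.Closure.ReflexiveTransitive using (Star)
import Relation.Binary.Construct.Union as Rel₂
open import Relation.Binary.Core using (Rel)
open import Relation.Binary.PropositionalEquality.Core using (_≡_; refl)
open import Relation.Nullary.Decidable.Core using (does; True; toWitness)
open import Relation.Nullary.Negation.Core using (¬_)
open import Relation.Unary using (Pred; _∪_; ｛_｝)

------------------------------------------------------------------------
-- Formulae

infixr 7 _∧_
infixr 6 _∨_

data Formula : Set where
  ⊤ ⊥      : Formula
  var ¬var : ℕ → Formula
  _∧_ _∨_  : Formula → Formula → Formula

-- A finite set of variables is represented by a list of its elements
-- without repetitions, considered up to permutation.  That V has no
-- repetitions is a consequence of φ LinearOn V.

infix 4 _LinearOn_

data _LinearOn_ : Formula → List ℕ → Set where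
  ⊤-on    : ⊤ LinearOn []
  ⊥-on    : ⊥ LinearOn []
  var-on  : ∀ x → var x LinearOn (x ∷ [])
  ¬var-on : ∀ x → ¬var x LinearOn (x ∷ [])
  ∧-on    : ∀ {φ ψ V₁ V₂ V} → φ LinearOn V₁ → ψ LinearOn V₂ →
            Disjoint V₁ V₂ → V ↭ V₁ ++ V₂ → (φ ∧ ψ) LinearOn V
  ∨-on    : ∀ {φ ψ V₁ V₂ V} → φ LinearOn V₁ → ψ LinearOn V₂ →
            Disjoint V₁ V₂ → V ↭ V₁ ++ V₂ → (φ ∨ ψ) LinearOn V

Linear : Pred Formula 0ℓ
Linear φ = ∃[ V ] φ LinearOn V

data ConstantFree : Pred Formula 0ℓ where
  var  : ∀ x → ConstantFree (var x)
  ¬var : ∀ x → ConstantFree (¬var x)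
  _∧_  : ∀ {φ ψ} → ConstantFree φ → ConstantFree ψ → ConstantFree (φ ∧ ψ)
  _∨_  : ∀ {φ ψ} → ConstantFree φ → ConstantFree ψ → ConstantFree (φ ∨ ψ)

data NegationFree : Pred Formula 0ℓ where
  ⊤   : NegationFree ⊤
  ⊥   : NegationFree ⊥
  var : ∀ x → NegationFree (var x)
  _∧_ : ∀ {φ ψ} → NegationFree φ → NegationFree ψ → NegationFree (φ ∧ ψ)
  _∨_ : ∀ {φ ψ} → NegationFree φ → NegationFree ψ → NegationFree (φ ∨ ψ)

------------------------------------------------------------------------
-- Substitution

-- Negation occurs only on variables, so substituting χ for x turns ¬x
-- into the De Morgan dual of χ.

dual : Formula → Formula
dual ⊤        = ⊥
dual ⊥        = ⊤
dual (var x)  = ¬var x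
dual (¬var x) = var x
dual (φ ∧ ψ)  = dual φ ∨ dual ψ
dual (φ ∨ ψ)  = dual φ ∧ dual ψ

infixl 8 _⟨_⟩ _[_/_]

_⟨_⟩ : Formula → (ℕ → Formula) → Formula
⊤       ⟨ σ ⟩ = ⊤
⊥       ⟨ σ ⟩ = ⊥
var x   ⟨ σ ⟩ = σ x
¬var x  ⟨ σ ⟩ = dual (σ x)
(φ ∧ ψ) ⟨ σ ⟩ = φ ⟨ σ ⟩ ∧ ψ ⟨ σ ⟩
(φ ∨ ψ) ⟨ σ ⟩ = φ ⟨ σ ⟩ ∨ ψ ⟨ σ ⟩

_[_/_] : Formula → Formula → ℕ → Formula
φ [ χ / x ] = φ ⟨ (λ y → if does (y ≟ x) then χ else var y) ⟩

------------------------------------------------------------------------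
-- Linear inferences

⟦_⟧ : Formula → (ℕ → Bool) → Bool
⟦ ⊤ ⟧      α = true
⟦ ⊥ ⟧      α = false
⟦ var x ⟧  α = α x
⟦ ¬var x ⟧ α = Bool.not (α x)
⟦ φ ∧ ψ ⟧  α = ⟦ φ ⟧ α Bool.∧ ⟦ ψ ⟧ α
⟦ φ ∨ ψ ⟧  α = ⟦ φ ⟧ α Bool.∨ ⟦ ψ ⟧ α

infix 4 _⊨_

_⊨_ : Rel Formula 0ℓ
φ ⊨ ψ = ∀ α → ⟦ φ ⟧ α ≡ true → ⟦ ψ ⟧ α ≡ true

record LinearInference : Set where
  field
    lhs rhs    : Formula
    lhs-linear : Linear lhs
    rhs-linear : Linear rhs
    valid      : lhs ⊨ rhs

open LinearInference public

vars : Formula → List ℕ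
vars ⊤        = []
vars ⊥        = []
vars (var x)  = x ∷ []
vars (¬var x) = x ∷ []
vars (φ ∧ ψ)  = vars φ ++ vars ψ
vars (φ ∨ ψ)  = vars φ ++ vars ψ

-- Only validity is asked of φ[⊤/x] → ψ[⊥/x]: replacing a variable by a
-- constant keeps a linear formula linear.

TrivialAt : ℕ → LinearInference → Set
TrivialAt x ι = lhs ι [ ⊤ / x ] ⊨ rhs ι [ ⊥ / x ]

Trivial : Pred LinearInference 0ℓ
Trivial ι = ∃[ x ] x ∈ vars (lhs ι) ++ vars (rhs ι) × TrivialAt x ι

NonTrivial : Pred LinearInference 0ℓ
NonTrivial ι = ¬ Trivial ι

------------------------------------------------------------------------
-- Derivability without units

infix 4 _∼ac_ _⇝[_]_ _⇝*[_]_

data _∼ac_ : Rel Formula 0ℓ where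
  ∼-refl  : ∀ {φ} → φ ∼ac φ
  ∼-sym   : ∀ {φ ψ} → φ ∼ac ψ → ψ ∼ac φ
  ∼-trans : ∀ {φ ψ χ} → φ ∼ac ψ → ψ ∼ac χ → φ ∼ac χ
  ∧-cong  : ∀ {φ φ′ ψ ψ′} → φ ∼ac φ′ → ψ ∼ac ψ′ → φ ∧ ψ ∼ac φ′ ∧ ψ′
  ∨-cong  : ∀ {φ φ′ ψ ψ′} → φ ∼ac φ′ → ψ ∼ac ψ′ → φ ∨ ψ ∼ac φ′ ∨ ψ′
  ∧-comm  : ∀ φ ψ → φ ∧ ψ ∼ac ψ ∧ φ
  ∨-comm  : ∀ φ ψ → φ ∨ ψ ∼ac ψ ∨ φ
  ∧-assoc : ∀ φ ψ χ → (φ ∧ ψ) ∧ χ ∼ac φ ∧ (ψ ∧ χ)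
  ∨-assoc : ∀ φ ψ χ → (φ ∨ ψ) ∨ χ ∼ac φ ∨ (ψ ∨ χ)

-- Step S relates linear formulae only.  Substitution is simultaneous; the
-- linearity of φ ⟨ σ ⟩ forces that of σ x for every variable x of φ.

data Step (S : Pred LinearInference 0ℓ) : Rel Formula 0ℓ where
  base  : ∀ {ι} → S ι → Step S (lhs ι) (rhs ι)
  subst : ∀ {φ ψ} σ → Step S φ ψ → Linear (φ ⟨ σ ⟩) → Linear (ψ ⟨ σ ⟩) →
          Step S (φ ⟨ σ ⟩) (ψ ⟨ σ ⟩)
  ∧ˡ    : ∀ {φ ψ} χ → Step S φ ψ → Linear (φ ∧ χ) → Linear (ψ ∧ χ) →
          Step S (φ ∧ χ) (ψ ∧ χ)
  ∧ʳ    : ∀ {φ ψ} χ → Step S φ ψ → Linear (χ ∧ φ) → Linear (χ ∧ ψ) →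
          Step S (χ ∧ φ) (χ ∧ ψ)
  ∨ˡ    : ∀ {φ ψ} χ → Step S φ ψ → Linear (φ ∨ χ) → Linear (ψ ∨ χ) →
          Step S (φ ∨ χ) (ψ ∨ χ)
  ∨ʳ    : ∀ {φ ψ} χ → Step S φ ψ → Linear (χ ∨ φ) → Linear (χ ∨ ψ) →
          Step S (χ ∨ φ) (χ ∨ ψ)

_⇝[_]_ : Formula → Pred LinearInference 0ℓ → Formula → Set
φ ⇝[ S ] ψ = ∃₂ λ φ′ ψ′ → φ ∼ac φ′ × Step S φ′ ψ′ × ψ′ ∼ac ψ

_⇝*[_]_ : Formula → Pred LinearInference 0ℓ → Formula → Set
φ ⇝*[ S ] ψ = Star ((λ φ′ ψ′ → φ′ ⇝[ S ] ψ′) Rel₂.∪ _∼ac_) φ ψ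

------------------------------------------------------------------------
-- Switch and medial

private
  lin-var : ∀ x → Linear (var x)
  lin-var x = _ , var-on x

  lin-∧ : ∀ {φ ψ} ((V₁ , _) : Linear φ) ((V₂ , _) : Linear ψ) →
          {True (disjoint? V₁ V₂)} → Linear (φ ∧ ψ)
  lin-∧ (_ , p) (_ , q) {d} = _ , ∧-on p q (toWitness d) ↭-refl

  lin-∨ : ∀ {φ ψ} ((V₁ , _) : Linear φ) ((V₂ , _) : Linear ψ) →
          {True (disjoint? V₁ V₂)} → Linear (φ ∨ ψ)
  lin-∨ (_ , p) (_ , q) {d} = _ , ∨-on p q (toWitness d) ↭-refl

  switch-valid : ∀ x y z → x Bool.∧ (y Bool.∨ z) ≡ true →
                 (x Bool.∧ y) Bool.∨ z ≡ true
  switch-valid true y z p = p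

  medial-valid : ∀ w x y z → (w Bool.∧ x) Bool.∨ (y Bool.∧ z) ≡ true →
                 (w Bool.∨ y) Bool.∧ (x Bool.∨ z) ≡ true
  medial-valid true  true  y    z    p = refl
  medial-valid true  false true true p = refl
  medial-valid false true  true true p = refl
  medial-valid false false true true p = refl

switch : LinearInference
switch = record
  { lhs        = x ∧ (y ∨ z)
  ; rhs        = (x ∧ y) ∨ z
  ; lhs-linear = lin-∧ (lin-var 0) (lin-∨ (lin-var 1) (lin-var 2))
  ; rhs-linear = lin-∨ (lin-∧ (lin-var 0) (lin-var 1)) (lin-var 2)
  ; valid      = λ α → switch-valid (α 0) (α 1) (α 2)
  }
  where
  x = var 0
  y = var 1
  z = var 2

medial : LinearInference
medial = record
  { lhs        = (w ∧ x) ∨ (y ∧ z)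
  ; rhs        = (w ∨ y) ∧ (x ∨ z)
  ; lhs-linear = lin-∨ (lin-∧ (lin-var 0) (lin-var 1))
                       (lin-∧ (lin-var 2) (lin-var 3))
  ; rhs-linear = lin-∧ (lin-∨ (lin-var 0) (lin-var 2))
                       (lin-∨ (lin-var 1) (lin-var 3))
  ; valid      = λ α → medial-valid (α 0) (α 1) (α 2) (α 3)
  }
  where
  w = var 0
  x = var 1
  y = var 2
  z = var 3

SwitchMedial : Pred LinearInference 0ℓ
SwitchMedial = ｛ switch ｝ ∪ ｛ medial ｝

module Submission where

open import Algebra.Bundles using (module CommutativeMonoid)
import Algebra.Properties.CommutativeSemigroup as CommutativeSemigroup
import Data.Bool.Base as Bool
open import Data.Bool.Base using (Bool; true; false; not; T; if_then_else_)
open import Data.Bool.ListAction using (all; any)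
import Data.Bool.Properties as Bool
open import Data.Bool.Properties using (T?; T-≡; T-∨; not-¬; not-involutive)
open import Data.Empty using (⊥-elim)
open import Data.List.Base
  using (List; []; _∷_; _++_; map; concatMap; filterᵇ; cartesianProductWith; length; null)
open import Data.List.Membership.Propositional using (_∈_; _∉_; lose; find)
open import Data.List.Membership.Propositional.Properties
  using ( ∈-++⁺ˡ; ∈-++⁺ʳ; ∈-++⁻; ∈-map⁺; ∈-filter⁺; ∈-concatMap⁺; ∈-downFrom⁺
        ; ∈-cartesianProductWith⁺; ∈-∃++)
open import Data.List.Membership.Propositional.Properties.WithK using (unique∧set⇒bag)
open import Data.List.Properties
  using (length-++; length-map; map-++; map-cong-local; ++-conicalˡ; ++-conicalʳ)
open import Data.List.Relation.Binary.BagAndSetEquality using (∼bag⇒↭)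
open import Data.List.Relation.Binary.Disjoint.Propositional using (Disjoint)
open import Data.List.Relation.Binary.Permutation.Propositional
  using (_↭_; ↭-refl; ↭-sym; ↭-trans; ↭-reflexive; ↭-prep; ↭⇒↭ₛ)
import Data.List.Relation.Binary.Permutation.Propositional.Properties as Permutation
open import Data.List.Relation.Binary.Permutation.Propositional.Properties
  using ( ∈-resp-↭; drop-∷; shift; ↭-length; ↭-empty-inv; ↭-singleton-inv
        ; ++⁺; ++⁺ˡ; ++⁺ʳ; ++-comm; ++-assoc; ++-commutativeMonoid)
import Data.List.Relation.Binary.Permutation.Setoid.Properties as Permutationₛ
import Data.List.Relation.Unary.All as All
open import Data.List.Relation.Unary.All using (All; []; _∷_)
import Data.List.Relation.Unary.All.Properties as All
open import Data.List.Relation.Unary.AllPairs using ([]; _∷_)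
open import Data.List.Relation.Unary.Any using (here; there)
import Data.List.Relation.Unary.Any.Properties as Any
open import Data.List.Relation.Unary.Unique.Propositional using (Unique)
import Data.List.Relation.Unary.Unique.Propositional.Properties as Unique
open import Data.Nat.Base using (ℕ; zero; suc; _+_; _≤_; _<_; _≤ᵇ_; z≤n; s≤s)
open import Data.Nat.Properties
  using ( _≟_; suc-injective; ≤-refl; ≤-reflexive; ≤-trans; ≤-total; ≤-pred; ≤⇒≤ᵇ
        ; <⇒≤; <⇒≢; <-irrefl; <-≤-trans; n≮0; m≤m+n; m<m+n; m<n+m; +-suc)
open import Data.List.Membership.DecPropositional _≟_ using (_∈?_)
open import Data.Product.Base using (∃; ∃₂; _×_; _,_; proj₁; proj₂; swap)
open import Data.Sum.Base using (_⊎_; inj₁; inj₂; [_,_]′)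
open import Function.Base using (_∘_; id)
open import Function.Bundles using (Equivalence; mk⇔)
open import Relation.Binary.Construct.Closure.ReflexiveTransitive
  using (Star; ε; _◅_; _◅◅_; gmap; return)
import Relation.Binary.Construct.Union as Rel₂
import Relation.Binary.PropositionalEquality as ≡
open import Relation.Binary.PropositionalEquality
  using (_≡_; _≢_; refl; sym; trans; cong; cong₂; setoid; ≢-sym)
open import Relation.Nullary using (¬_; Dec; yes; no; does)
open import Relation.Nullary.Decidable using (dec-true; dec-false)
open import Defs hiding (dual)

-- By induction on the number of variables.  If ψ = ψ₁ ∧ ψ₂, let φᵢ be φ with the variables of the
-- other conjunct set to ⊤.  Nontriviality forces φᵢ to depend on all variables of ψᵢ, and then
-- medial alone takes φ to φ₁ ∧ φ₂, where each φᵢ → ψᵢ is nontrivial; dually if φ = φ₁ ∨ φ₂.  If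
-- φ = x ∧ φ′, nontriviality forces switch to take x ∧ ψ[⊤/x] to ψ, and φ′ → ψ[⊤/x] is
-- nontrivial; dually if ψ = x ∨ ψ′.  Otherwise φ is a conjunction of disjunctions R ∧ (X ∨ D)
-- and ψ a disjunction of conjunctions, and a finite check shows that, for at most seven
-- variables, either some top-level switch of φ to (R ∧ X) ∨ D still entails ψ, or dually for ψ;
-- this leads back to the first case.

-- The induction has to stay among nontrivial inferences. For example x ∧ y → x ∨ y is valid but
-- trivial, and it is not derivable, since switch needs three subformulae and medial four. So
-- whenever a conjunct or a variable is split off, a triviality of the smaller inference must be
-- lifted to one of the original inference.
--
-- The switch found by the finite check needs no such care. If φ derives χ and χ → ψ is trivial at a
-- variable, then φ → ψ is trivial there too, because derivations are sound. Hence the check looks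
-- at entailment alone and runs over all valid φ → ψ of the remaining shape, trivial or not.
--
-- The check is the only place where the bound 8 enters; splitting and peeling work for any number
-- of variables. A switch does not lower that number: the descent comes from the splitting that it
-- makes possible.

-- Constant-free, negation-free formulae as trees

data Conn : Set where
  conj disj : Conn

-- The connective is an argument of `node`, so that whatever is symmetric in conjunction and
-- disjunction is proved once.
data Tree : Set where
  leaf : ℕ → Tree
  node : Conn → Tree → Tree → Tree

infixr 7 _⊓_
infixr 6 _⊔_

pattern _⊓_ a b = node conj a b
pattern _⊔_ a b = node disj a b

flip : Conn → Conn
flip conj = disj
flip disj = conj

-- Leaves are not negated: this is the Boolean dual α ↦ ¬ t(¬ α). It stays among negation-free trees
-- and reverses entailment.
dual : Tree → Tree
dual (leaf x)     = leaf x
dual (node c a b) = node (flip c) (dual a) (dual b)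

⟪_⟫ : Conn → Bool → Bool → Bool
⟪ conj ⟫ = Bool._∧_
⟪ disj ⟫ = Bool._∨_

Assignment : Set
Assignment = ℕ → Bool

eval : Tree → Assignment → Bool
eval (leaf x)     α = α x
eval (node c a b) α = ⟪ c ⟫ (eval a α) (eval b α)

infix 4 _⊑_ _⊩_

_⊑_ : Bool → Bool → Set
b ⊑ b′ = b ≡ true → b′ ≡ true

_⊩_ : Tree → Tree → Set
a ⊩ b = ∀ α → eval a α ⊑ eval b α

infix 4 _≃_ _⊸_ _⟶_

data _≃_ : Tree → Tree → Set where
  ≃-refl  : ∀ {a} → a ≃ a
  ≃-sym   : ∀ {a b} → a ≃ b → b ≃ a
  ≃-trans : ∀ {a b d} → a ≃ b → b ≃ d → a ≃ d
  ≃-cong  : ∀ c {a a′ b b′} → a ≃ a′ → b ≃ b′ → node c a b ≃ node c a′ b′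
  ≃-comm  : ∀ c a b → node c a b ≃ node c b a
  ≃-assoc : ∀ c a b d → node c (node c a b) d ≃ node c a (node c b d)

-- Closure under substitution is built into `sw` and `md`. Linearity is not asked of single steps:
-- derivations preserve the leaves up to permutation, so distinct leaves at the start give linearity
-- throughout.
data _⊸_ : Tree → Tree → Set where
  sw : ∀ x y z → x ⊓ (y ⊔ z) ⊸ (x ⊓ y) ⊔ z
  md : ∀ w x y z → (w ⊓ x) ⊔ (y ⊓ z) ⊸ (w ⊔ y) ⊓ (x ⊔ z)
  left  : ∀ c {a a′} b → a ⊸ a′ → node c a b ⊸ node c a′ b
  right : ∀ c a {b b′} → b ⊸ b′ → node c a b ⊸ node c a b′

_⟶_ : Tree → Tree → Set
_⟶_ = Star (_≃_ Rel₂.∪ _⊸_)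

ac : ∀ {a b} → a ≃ b → a ⟶ b
ac e = return (inj₁ e)

step : ∀ {a b} → a ⊸ b → a ⟶ b
step s = return (inj₂ s)

-- Lists without repetitions, leaves and sizes

module _ {a} {A : Set a} where

  open CommutativeSemigroup
    (CommutativeMonoid.commutativeSemigroup (++-commutativeMonoid {A = A})) public
    using () renaming (interchange to ++-interchange)

  Unique-resp-↭ : {xs ys : List A} → xs ↭ ys → Unique xs → Unique ys
  Unique-resp-↭ xs↭ys = Permutationₛ.Unique-resp-↭ (setoid A) (↭⇒↭ₛ xs↭ys)

  unique-++⁻ : ∀ xs {ys : List A} → Unique (xs ++ ys) →
               Unique xs × Unique ys × Disjoint xs ys
  unique-++⁻ []       u       = [] , u , λ ()
  unique-++⁻ (x ∷ xs) (p ∷ u) =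
    let uˡ , uʳ , d = unique-++⁻ xs u in
    All.++⁻ˡ xs p ∷ uˡ , uʳ ,
    λ { (here refl , v∈ys)  → All.lookup (All.++⁻ʳ xs p) v∈ys refl
      ; (there v∈xs , v∈ys) → d (v∈xs , v∈ys) }

leaves : Tree → List ℕ
leaves (leaf x)     = x ∷ []
leaves (node c a b) = leaves a ++ leaves b

some-leaf : ∀ t → ∃ λ x → x ∈ leaves t
some-leaf (leaf x)     = x , here refl
some-leaf (node c a b) = let x , x∈a = some-leaf a in x , ∈-++⁺ˡ x∈a

size : Tree → ℕ
size t = length (leaves t)

size>0 : ∀ t → 0 < size t
size>0 t with leaves t | some-leaf t
... | _ ∷ _ | _ = s≤s z≤n

-- Evaluation

⟪⟫-mono : ∀ c {a a′ b b′} → a ⊑ a′ → b ⊑ b′ → ⟪ c ⟫ a b ⊑ ⟪ c ⟫ a′ b′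
⟪⟫-mono conj {true} {b = true}       f g _ = cong₂ Bool._∧_ (f refl) (g refl)
⟪⟫-mono disj {true}                  f g _ = cong (Bool._∨ _) (f refl)
⟪⟫-mono disj {false} {a′} {b = true} f g _ = trans (cong (a′ Bool.∨_) (g refl)) (Bool.∨-zeroʳ a′)

⟪⟫-comm : ∀ c b b′ → ⟪ c ⟫ b b′ ≡ ⟪ c ⟫ b′ b
⟪⟫-comm conj = Bool.∧-comm
⟪⟫-comm disj = Bool.∨-comm

⟪⟫-assoc : ∀ c b₁ b₂ b₃ → ⟪ c ⟫ (⟪ c ⟫ b₁ b₂) b₃ ≡ ⟪ c ⟫ b₁ (⟪ c ⟫ b₂ b₃)
⟪⟫-assoc conj = Bool.∧-assoc
⟪⟫-assoc disj = Bool.∨-assoc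

eval-mono : ∀ t {α β} → (∀ {x} → x ∈ leaves t → α x ⊑ β x) → eval t α ⊑ eval t β
eval-mono (leaf x)     h = h (here refl)
eval-mono (node c a b) h =
  ⟪⟫-mono c (eval-mono a (h ∘ ∈-++⁺ˡ)) (eval-mono b (h ∘ ∈-++⁺ʳ (leaves a)))

eval-cong : ∀ t {α β} → (∀ {x} → x ∈ leaves t → α x ≡ β x) → eval t α ≡ eval t β
eval-cong (leaf x)     h = h (here refl)
eval-cong (node c a b) h =
  cong₂ ⟪ c ⟫ (eval-cong a (h ∘ ∈-++⁺ˡ)) (eval-cong b (h ∘ ∈-++⁺ʳ (leaves a)))

eval-true : ∀ t {α} → (∀ {x} → x ∈ leaves t → α x ≡ true) → eval t α ≡ true
eval-true t {α} h = trans (eval-cong t h) (const t)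
  where
  const : ∀ t → eval t (λ _ → true) ≡ true
  const (leaf x) = refl
  const (a ⊓ b)  = cong₂ Bool._∧_ (const a) (const b)
  const (a ⊔ b)  = cong (Bool._∨ _) (const a)

∧-elim : ∀ {b b′} → b Bool.∧ b′ ≡ true → b ≡ true × b′ ≡ true
∧-elim {true} p = refl , p

∨-introˡ : ∀ {b} b′ → b ⊑ b Bool.∨ b′
∨-introˡ b′ = cong (Bool._∨ b′)

-- Derivations

≃-eval : ∀ {a b} → a ≃ b → ∀ α → eval a α ≡ eval b α
≃-eval ≃-refl            α = refl
≃-eval (≃-sym e)         α = sym (≃-eval e α)
≃-eval (≃-trans e f)     α = trans (≃-eval e α) (≃-eval f α)
≃-eval (≃-cong c e f)    α = cong₂ ⟪ c ⟫ (≃-eval e α) (≃-eval f α)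
≃-eval (≃-comm c a b)    α = ⟪⟫-comm c (eval a α) (eval b α)
≃-eval (≃-assoc c a b d) α = ⟪⟫-assoc c (eval a α) (eval b α) (eval d α)

⊸-sound : ∀ {a b} → a ⊸ b → a ⊩ b
⊸-sound (sw x y z) α with eval x α
... | true = id
⊸-sound (md w x y z) α with eval w α | eval x α | eval y α | eval z α
... | true  | true | _    | _    = λ _ → refl
... | true  | false | true | true = λ _ → refl
... | false | true | true | true = λ _ → refl
... | false | false | true | true = λ _ → refl
⊸-sound (left c b s)  α = ⟪⟫-mono c (⊸-sound s α) id
⊸-sound (right c a s) α = ⟪⟫-mono c id (⊸-sound s α)

⟶-sound : ∀ {a b} → a ⟶ b → a ⊩ b
⟶-sound ε            α = id
⟶-sound (inj₁ e ◅ r) α = ⟶-sound r α ∘ trans (sym (≃-eval e α))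
⟶-sound (inj₂ s ◅ r) α = ⟶-sound r α ∘ ⊸-sound s α

≃-leaves : ∀ {a b} → a ≃ b → leaves a ↭ leaves b
≃-leaves ≃-refl            = ↭-refl
≃-leaves (≃-sym e)         = ↭-sym (≃-leaves e)
≃-leaves (≃-trans e f)     = ↭-trans (≃-leaves e) (≃-leaves f)
≃-leaves (≃-cong c e f)    = ++⁺ (≃-leaves e) (≃-leaves f)
≃-leaves (≃-comm c a b)    = ++-comm (leaves a) (leaves b)
≃-leaves (≃-assoc c a b d) = ++-assoc (leaves a) (leaves b) (leaves d)

⊸-leaves : ∀ {a b} → a ⊸ b → leaves a ↭ leaves b
⊸-leaves (sw x y z)    = ↭-sym (++-assoc (leaves x) (leaves y) (leaves z))
⊸-leaves (md w x y z)  = ++-interchange (leaves w) (leaves x) (leaves y) (leaves z)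
⊸-leaves (left c b s)  = ++⁺ʳ (leaves b) (⊸-leaves s)
⊸-leaves (right c a s) = ++⁺ˡ (leaves a) (⊸-leaves s)

⟶-leaves : ∀ {a b} → a ⟶ b → leaves a ↭ leaves b
⟶-leaves ε            = ↭-refl
⟶-leaves (inj₁ e ◅ r) = ↭-trans (≃-leaves e) (⟶-leaves r)
⟶-leaves (inj₂ s ◅ r) = ↭-trans (⊸-leaves s) (⟶-leaves r)

⟶-cong : ∀ c {a a′ b b′} → a ⟶ a′ → b ⟶ b′ → node c a b ⟶ node c a′ b′
⟶-cong c {a′ = a′} {b} r s =
  gmap (λ x → node c x b) [ (λ e → inj₁ (≃-cong c e ≃-refl)) , (λ s → inj₂ (left c b s)) ]′ r ◅◅
  gmap (node c a′) [ (λ e → inj₁ (≃-cong c ≃-refl e)) , (λ s → inj₂ (right c a′ s)) ]′ s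

-- Duality

flip-involutive : ∀ c → flip (flip c) ≡ c
flip-involutive conj = refl
flip-involutive disj = refl

dual-involutive : ∀ t → dual (dual t) ≡ t
dual-involutive (leaf x) = refl
dual-involutive (node c a b)
  rewrite flip-involutive c | dual-involutive a | dual-involutive b = refl

leaves-dual : ∀ t → leaves (dual t) ≡ leaves t
leaves-dual (leaf x)     = refl
leaves-dual (node c a b) = cong₂ _++_ (leaves-dual a) (leaves-dual b)

eval-dual : ∀ t α → eval (dual t) α ≡ not (eval t (not ∘ α))
eval-dual (leaf x) α = sym (not-involutive (α x))
eval-dual (a ⊓ b)  α
  rewrite eval-dual a α | eval-dual b α with eval a (not ∘ α)
... | true  = refl
... | false = refl
eval-dual (a ⊔ b)  α
  rewrite eval-dual a α | eval-dual b α with eval a (not ∘ α)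
... | true  = refl
... | false = refl

not-⊑ : ∀ b b′ → b ⊑ b′ → not b′ ⊑ not b
not-⊑ false _     f p = refl
not-⊑ true  false f p = f refl

-- Two assignments are needed because triviality compares the two sides at assignments that differ
-- in one variable.
dual-⊑ : ∀ a b α β → eval a (not ∘ α) ⊑ eval b (not ∘ β) → eval (dual b) β ⊑ eval (dual a) α
dual-⊑ a b α β f rewrite eval-dual a α | eval-dual b β = not-⊑ (eval a (not ∘ α)) _ f

dual-⊩ : ∀ {a b} → a ⊩ b → dual b ⊩ dual a
dual-⊩ {a} {b} f α = dual-⊑ a b α α (f (not ∘ α))

dual-≃ : ∀ {a b} → a ≃ b → dual a ≃ dual b
dual-≃ ≃-refl            = ≃-refl
dual-≃ (≃-sym e)         = ≃-sym (dual-≃ e)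
dual-≃ (≃-trans e f)     = ≃-trans (dual-≃ e) (dual-≃ f)
dual-≃ (≃-cong c e f)    = ≃-cong (flip c) (dual-≃ e) (dual-≃ f)
dual-≃ (≃-comm c a b)    = ≃-comm (flip c) (dual a) (dual b)
dual-≃ (≃-assoc c a b d) = ≃-assoc (flip c) (dual a) (dual b) (dual d)

-- Medial is its own dual with the middle arguments exchanged, and switch is its own dual up to
-- commutativity.
dual-⊸ : ∀ {a b} → a ⊸ b → dual b ⟶ dual a
dual-⊸ (sw x y z) =
  ac (≃-trans (≃-comm conj _ _) (≃-cong conj ≃-refl (≃-comm disj _ _))) ◅◅
  step (sw (dual z) (dual y) (dual x)) ◅◅
  ac (≃-trans (≃-comm disj _ _) (≃-cong disj ≃-refl (≃-comm conj _ _)))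
dual-⊸ (md w x y z)  = step (md (dual w) (dual y) (dual x) (dual z))
dual-⊸ (left c b s)  = ⟶-cong (flip c) (dual-⊸ s) ε
dual-⊸ (right c a s) = ⟶-cong (flip c) ε (dual-⊸ s)

dual-⟶ : ∀ {a b} → a ⟶ b → dual b ⟶ dual a
dual-⟶ ε            = ε
dual-⟶ (inj₁ e ◅ r) = dual-⟶ r ◅◅ ac (dual-≃ (≃-sym e))
dual-⟶ (inj₂ s ◅ r) = dual-⟶ r ◅◅ dual-⊸ s

-- Nontrivial inferences

Off : ℕ → Assignment → Assignment → Set
Off x α β = ∀ {y} → y ≢ x → α y ≡ β y

-- By monotonicity this is equivalent to a[⊤/x] ⊩ b[⊥/x].
TrivialIn : ℕ → Tree → Tree → Set
TrivialIn x a b = ∀ {α β} → Off x α β → eval a α ⊑ eval b β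

record Inference (a b : Tree) : Set where
  field
    unique     : Unique (leaves a)
    same       : leaves a ↭ leaves b
    entails    : a ⊩ b
    nontrivial : ∀ {x} → x ∈ leaves a → ¬ TrivialIn x a b

  uniqueʳ : Unique (leaves b)
  uniqueʳ = Unique-resp-↭ same unique

open Inference

dual-inference : ∀ {a b} → Inference a b → Inference (dual b) (dual a)
dual-inference {a} {b} i = record
  { unique     = ≡.subst Unique (sym (leaves-dual b)) (uniqueʳ i)
  ; same       = ≡.subst₂ _↭_ (sym (leaves-dual b)) (sym (leaves-dual a)) (↭-sym (same i))
  ; entails    = dual-⊩ {a} {b} (entails i)
  ; nontrivial = λ x∈b tr →
      nontrivial i (∈-resp-↭ (↭-sym (same i)) (≡.subst (_ ∈_) (leaves-dual b) x∈b))
        λ {α} {β} off → ≡.subst₂ (λ a′ b′ → eval a′ α ⊑ eval b′ β)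
          (dual-involutive a) (dual-involutive b)
          (dual-⊑ (dual b) (dual a) β α (tr (sym ∘ cong not ∘ off)))
  }

-- Soundness of `r` turns a triviality of the new inference into one of the old inference, so only
-- the entailment has to be supplied.
advance : ∀ {a a′ b} → a ⟶ a′ → a′ ⊩ b → Inference a b → Inference a′ b
advance r v i = record
  { unique     = Unique-resp-↭ (⟶-leaves r) (unique i)
  ; same       = ↭-trans (↭-sym (⟶-leaves r)) (same i)
  ; entails    = v
  ; nontrivial = λ x∈a′ tr → nontrivial i (∈-resp-↭ (↭-sym (⟶-leaves r)) x∈a′)
                   λ off → tr off ∘ ⟶-sound r _
  }

≃-interchange : ∀ c w x y z →
  node c (node c w x) (node c y z) ≃ node c (node c w y) (node c x z)
≃-interchange c w x y z =
  ≃-trans (≃-assoc c w x (node c y z))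
    (≃-trans (≃-cong c ≃-refl
      (≃-trans (≃-sym (≃-assoc c x y z))
        (≃-trans (≃-cong c (≃-comm c x y) ≃-refl) (≃-assoc c y x z))))
      (≃-sym (≃-assoc c w y (node c x z))))

Below : ℕ → Set
Below n = ∀ {a b} → size a < n → Inference a b → a ⟶ b

set⇒↭ : {xs ys : List ℕ} → Unique xs → Unique ys →
  (∀ {x} → x ∈ xs → x ∈ ys) → (∀ {x} → x ∈ ys → x ∈ xs) → xs ↭ ys
set⇒↭ u v f g = ∼bag⇒↭ (unique∧set⇒bag u v (mk⇔ f g))

-- Splitting a tree along a two-colouring of its variables

module Colouring (colour : ℕ → Bool) where

  -- An assignment keep k α sets the variables of the colour other than k to ⊤.
  keep : Bool → Assignment → Assignment
  keep k α x = if does (colour x Bool.≟ k) then α x else true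

  keep-same : ∀ {k} α {x} → colour x ≡ k → keep k α x ≡ α x
  keep-same {k} α {x} p rewrite dec-true (colour x Bool.≟ k) p = refl

  keep-other : ∀ {k} α {x} → colour x ≢ k → keep k α x ≡ true
  keep-other {k} α {x} p rewrite dec-false (colour x Bool.≟ k) p = refl

  keep-⊑ : ∀ k α x → α x ⊑ keep k α x
  keep-⊑ k α x p with does (colour x Bool.≟ k)
  ... | true  = p
  ... | false = refl

  keep-Off : ∀ {x α β} k → Off x α β → Off x (keep k α) (keep k β)
  keep-Off k off {y} y≢x with does (colour y Bool.≟ k)
  ... | true  = off y≢x
  ... | false = refl

  Mono : Bool → Tree → Set
  Mono k t = ∀ {x} → x ∈ leaves t → colour x ≡ k

  -- As `Off` is symmetric, this says that t no longer depends on x once the other colour is set to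
  -- ⊤.
  Lost : ℕ → Tree → Set
  Lost x t = ∀ {α β} → Off x α β →
    eval t (keep (colour x) α) ⊑ eval t (keep (colour x) β)

  -- In `mixed`, the last field identifies `part k` with t where the other colour is set to ⊤. Trees
  -- have no units, so `mono` is separate: there one part would be ⊤.
  data Split (t : Tree) : Set where
    mono  : ∀ k → Mono k t → Split t
    mixed : (part : Bool → Tree) → t ⟶ part true ⊓ part false →
            (∀ k → Mono k (part k)) →
            (∀ k α → eval t (keep k α) ≡ eval (part k) α) → Split t
    lost  : ∀ x → x ∈ leaves t → Lost x t → Split t

  Mono-eval : ∀ {k} t → Mono k t → ∀ α → eval t (keep k α) ≡ eval t α
  Mono-eval t m α = eval-cong t (keep-same α ∘ m)

  Mono-true : ∀ {k k′} t → Mono k t → k ≢ k′ → ∀ α → eval t (keep k′ α) ≡ true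
  Mono-true t m k≢k′ α = eval-true t λ x∈t → keep-other α (k≢k′ ∘ trans (sym (m x∈t)))

  split-comm : ∀ {c a b} → Split (node c a b) → Split (node c b a)
  split-comm {c} {a} {b} (mono k m) = mono k (m ∘ ∈-resp-↭ (++-comm (leaves b) (leaves a)))
  split-comm {c} {a} {b} (mixed part r ms es) =
    mixed part (ac (≃-comm c b a) ◅◅ r) ms
      (λ k α → trans (⟪⟫-comm c (eval b (keep k α)) (eval a (keep k α))) (es k α))
  split-comm {c} {a} {b} (lost x x∈ l) =
    lost x (∈-resp-↭ (++-comm (leaves a) (leaves b)) x∈)
      λ {α} {β} off → ≡.subst₂ _⊑_ (⟪⟫-comm c _ (eval b _)) (⟪⟫-comm c _ (eval b _)) (l off)

  unaffected : ∀ {x α β} k t → x ∉ leaves t → Off x α β →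
    eval t (keep k α) ≡ eval t (keep k β)
  unaffected k t x∉t off = eval-cong t λ y∈t → keep-Off k off λ { refl → x∉t y∈t }

  lost-right : ∀ c a {b x} → Disjoint (leaves a) (leaves b) →
    x ∈ leaves b → Lost x b → Split (node c a b)
  lost-right c a {x = x} d x∈b l = lost x (∈-++⁺ʳ (leaves a) x∈b) λ {α} {β} off →
    ⟪⟫-mono c (trans (sym (unaffected (colour x) a (λ x∈a → d (x∈a , x∈b)) off))) (l off)

  choose : Tree → Tree → Bool → Tree
  choose a b true  = a
  choose a b false = b

  split-⊓₂ : ∀ a b → Mono true a → Mono false b → Split (a ⊓ b)
  split-⊓₂ a b m n = mixed (choose a b) ε
    (λ { true → m ; false → n })
    λ { true  α → trans (cong₂ Bool._∧_ (Mono-eval a m α) (Mono-true b n (λ ()) α))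
                    (Bool.∧-comm _ true)
      ; false α → cong₂ Bool._∧_ (Mono-true a m (λ ()) α) (Mono-eval b n α) }

  -- A monochromatic conjunct is absorbed into the part of its own colour, and becomes that part if
  -- there is none yet.
  split-⊓₁ : ∀ {k} a {b} → Disjoint (leaves a) (leaves b) →
    Mono k a → Split b → Split (a ⊓ b)
  split-⊓₁ {true} a d m (mono true m′) = mono true λ x∈ → [ m , m′ ]′ (∈-++⁻ (leaves a) x∈)
  split-⊓₁ {false} a d m (mono false m′) = mono false λ x∈ → [ m , m′ ]′ (∈-++⁻ (leaves a) x∈)
  split-⊓₁ {true} a {b} d m (mono false m′) = split-⊓₂ a b m m′
  split-⊓₁ {false} a {b} d m (mono true m′) = split-comm (split-⊓₂ b a m′ m)
  split-⊓₁ {true} a {b} d m (mixed part r ms es) =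
    mixed (choose (a ⊓ part true) (part false))
      (⟶-cong conj ε r ◅◅ ac (≃-sym (≃-assoc conj a _ _)))
      (λ { true x∈ → [ m , ms true ]′ (∈-++⁻ (leaves a) x∈) ; false → ms false })
      λ { true  α → cong₂ Bool._∧_ (Mono-eval a m α) (es true α)
        ; false α → cong₂ Bool._∧_ (Mono-true a m (λ ()) α) (es false α) }
  split-⊓₁ {false} a {b} d m (mixed part r ms es) =
    mixed (choose (part true) (a ⊓ part false))
      (⟶-cong conj ε (r ◅◅ ac (≃-comm conj _ _)) ◅◅
        ac (≃-trans (≃-sym (≃-assoc conj a _ _)) (≃-comm conj _ _)))
      (λ { false x∈ → [ m , ms false ]′ (∈-++⁻ (leaves a) x∈) ; true → ms true })
      λ { true  α → cong₂ Bool._∧_ (Mono-true a m (λ ()) α) (es true α)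
        ; false α → cong₂ Bool._∧_ (Mono-eval a m α) (es false α) }
  split-⊓₁ a {b} d m (lost x x∈b l) = lost-right conj a {b} d x∈b l

  -- Keeping only the colour of x turns a into ⊤, and with it the whole disjunction, whatever the
  -- value of x.
  mono-⊔-lost : ∀ {k} a {b x} → Mono k a → x ∈ leaves b → colour x ≢ k → Split (a ⊔ b)
  mono-⊔-lost a {x = x} m x∈b cx≢k = lost x (∈-++⁺ʳ (leaves a) x∈b) λ {α} {β} _ _ →
    ∨-introˡ _ (Mono-true a m (cx≢k ∘ sym) β)

  split-⊔₁ : ∀ {k} a {b} → Disjoint (leaves a) (leaves b) →
    Mono k a → Split b → Split (a ⊔ b)
  split-⊔₁ {k} a {b} d m (mono k′ m′) with k′ Bool.≟ k
  ... | yes refl = mono k λ x∈ → [ m , m′ ]′ (∈-++⁻ (leaves a) x∈)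
  ... | no k′≢k  = let x , x∈b = some-leaf b in
    mono-⊔-lost a m x∈b (k′≢k ∘ trans (sym (m′ x∈b)))
  split-⊔₁ {k} a {b} d m (mixed part r ms es) =
    -- Any variable of the colour absent from a is lost, and `part (not k)` supplies one.
    let x , x∈ = some-leaf (part (not k)) in
    mono-⊔-lost a m (∈-resp-↭ (↭-sym (⟶-leaves r)) (∈part (not k) x∈))
      (λ cx≡k → not-¬ refl (trans (sym cx≡k) (ms (not k) x∈)))
    where
    ∈part : ∀ k {x} → x ∈ leaves (part k) → x ∈ leaves (part true ⊓ part false)
    ∈part true  = ∈-++⁺ˡ
    ∈part false = ∈-++⁺ʳ (leaves (part true))
  split-⊔₁ a d m (lost x x∈b l) = lost-right disj a d x∈b l

  -- This is why medial suffices: a disjunction that loses no variable is either monochromatic or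
  -- has both disjuncts mixed, and then medial joins their parts colour by colour.
  split-node : ∀ c {a b} → Disjoint (leaves a) (leaves b) →
    Split a → Split b → Split (node c a b)
  split-node c {a} {b} d s (lost x x∈b l) = lost-right c a d x∈b l
  split-node c {a} {b} d (lost x x∈a l) s = split-comm (lost-right c b (d ∘ swap) x∈a l)
  split-node conj {a} d (mono k m) s = split-⊓₁ a d m s
  split-node disj {a} d (mono k m) s = split-⊔₁ a d m s
  split-node conj {b = b} d s (mono k m) = split-comm (split-⊓₁ b (d ∘ swap) m s)
  split-node disj {b = b} d s (mono k m) = split-comm (split-⊔₁ b (d ∘ swap) m s)
  split-node conj d (mixed p r ms es) (mixed p′ r′ ms′ es′) =
    mixed (λ k → p k ⊓ p′ k)
      (⟶-cong conj r r′ ◅◅ ac (≃-interchange conj _ _ _ _))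
      (λ k x∈ → [ ms k , ms′ k ]′ (∈-++⁻ (leaves (p k)) x∈))
      (λ k α → cong₂ Bool._∧_ (es k α) (es′ k α))
  split-node disj d (mixed p r ms es) (mixed p′ r′ ms′ es′) =
    mixed (λ k → p k ⊔ p′ k)
      (⟶-cong disj r r′ ◅◅ step (md _ _ _ _))
      (λ k x∈ → [ ms k , ms′ k ]′ (∈-++⁻ (leaves (p k)) x∈))
      (λ k α → cong₂ Bool._∨_ (es k α) (es′ k α))

  split : ∀ t → Unique (leaves t) → Split t
  split (leaf x)     u = mono (colour x) λ { (here refl) → refl }
  split (node c a b) u =
    let uᵃ , uᵇ , d = unique-++⁻ (leaves a) u in split-node c d (split a uᵃ) (split b uᵇ)

-- Conjunctions on the right and disjunctions on the left

split-rhs : ∀ {n a b₁ b₂} → Below n → size a ≤ n → Inference a (b₁ ⊓ b₂) → a ⟶ b₁ ⊓ b₂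
split-rhs {n} {a} {b₁} {b₂} ih a≤n i = go (split a (unique i))
  where
  colour : ℕ → Bool
  colour x = does (x ∈? leaves b₁)
  open Colouring colour

  b : Bool → Tree
  b true  = b₁
  b false = b₂

  disjoint : Disjoint (leaves b₁) (leaves b₂)
  disjoint = proj₂ (proj₂ (unique-++⁻ (leaves b₁) (uniqueʳ i)))

  colour-b : ∀ k → Mono k (b k)
  colour-b true  {x} x∈ = dec-true (x ∈? leaves b₁) x∈
  colour-b false {x} x∈ = dec-false (x ∈? leaves b₁) λ x∈b₁ → disjoint (x∈b₁ , x∈)

  ∈-b : ∀ {x k} → x ∈ leaves a → colour x ≡ k → x ∈ leaves (b k)
  ∈-b x∈a refl with ∈-++⁻ (leaves b₁) (∈-resp-↭ (same i) x∈a)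
  ... | inj₁ x∈b₁ = ≡.subst (λ k → _ ∈ leaves (b k)) (sym (colour-b true x∈b₁)) x∈b₁
  ... | inj₂ x∈b₂ = ≡.subst (λ k → _ ∈ leaves (b k)) (sym (colour-b false x∈b₂)) x∈b₂

  b∈ : ∀ k {x} → x ∈ leaves (b k) → x ∈ leaves a
  b∈ true  = ∈-resp-↭ (↭-sym (same i)) ∘ ∈-++⁺ˡ
  b∈ false = ∈-resp-↭ (↭-sym (same i)) ∘ ∈-++⁺ʳ (leaves b₁)

  valid-b : ∀ k {α} → eval a α ≡ true → eval (b k) α ≡ true
  valid-b true  {α} p = proj₁ (∧-elim {eval b₁ α} (entails i α p))
  valid-b false {α} p = proj₂ (∧-elim {eval b₁ α} (entails i α p))

  eval-b : ∀ {α} → (∀ k → eval (b k) α ≡ true) → eval (b₁ ⊓ b₂) α ≡ true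
  eval-b f = cong₂ Bool._∧_ (f true) (f false)

  -- Only the conjunct of the colour of x matters, since the other one does not mention x.
  trivial : ∀ x → (∀ {α β} → Off x α β → eval a α ⊑ eval (b (colour x)) β) →
    TrivialIn x a (b₁ ⊓ b₂)
  trivial x f {α} {β} off p = eval-b λ k → side k (k Bool.≟ colour x)
    where
    side : ∀ k → Dec (k ≡ colour x) → eval (b k) β ≡ true
    side k (yes refl) = f off p
    side k (no k≢cx)  =
      trans (sym (eval-cong (b k) λ y∈ → off λ { refl → k≢cx (sym (colour-b k y∈)) })) (valid-b k p)

  go : Split a → a ⟶ b₁ ⊓ b₂
  -- The conjunct of the absent colour has a variable, and this variable also occurs in a.
  go (mono k m) = ⊥-elim (not-¬ {k} refl (trans (sym (m (b∈ (not k) x∈))) (colour-b (not k) x∈)))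
    where
    x∈ = proj₂ (some-leaf (b (not k)))
  -- By monotonicity a stays true when the other colour is raised to ⊤. Then x may be changed
  -- freely, and the conjunct containing x does not see the raised variables.
  go (lost x x∈a l) = ⊥-elim (nontrivial i x∈a (trivial x λ {α} {β} off p →
    trans (sym (Mono-eval (b (colour x)) (colour-b (colour x)) β))
      (valid-b (colour x) (l off (eval-mono a (λ {y} _ → keep-⊑ (colour x) α y) p)))))
  go (mixed part r ms es) = r ◅◅ ⟶-cong conj
    (ih (<-≤-trans size₁ a≤n) (inference true))
    (ih (<-≤-trans size₂ a≤n) (inference false))
    where
    p₁ = leaves (part true)
    p₂ = leaves (part false)

    size-a : size a ≡ size (part true) + size (part false)
    size-a = trans (↭-length (⟶-leaves r)) (length-++ p₁)

    size₁ : size (part true) < size a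
    size₁ = ≡.subst (size (part true) <_) (sym size-a) (m<m+n _ (size>0 (part false)))

    size₂ : size (part false) < size a
    size₂ = ≡.subst (size (part false) <_) (sym size-a) (m<n+m _ (size>0 (part true)))

    ∈a : ∀ k {x} → x ∈ leaves (part k) → x ∈ leaves a
    ∈a true  = ∈-resp-↭ (↭-sym (⟶-leaves r)) ∘ ∈-++⁺ˡ
    ∈a false = ∈-resp-↭ (↭-sym (⟶-leaves r)) ∘ ∈-++⁺ʳ p₁

    ∈part : ∀ k {x} → x ∈ leaves a → colour x ≡ k → x ∈ leaves (part k)
    ∈part k x∈a cx with ∈-++⁻ p₁ (∈-resp-↭ (⟶-leaves r) x∈a)
    ... | inj₁ x∈ = ≡.subst (λ k → _ ∈ leaves (part k)) (trans (sym (ms true x∈)) cx) x∈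
    ... | inj₂ x∈ = ≡.subst (λ k → _ ∈ leaves (part k)) (trans (sym (ms false x∈)) cx) x∈

    parts-unique = unique-++⁻ p₁ (Unique-resp-↭ (⟶-leaves r) (unique i))
    b-unique = unique-++⁻ (leaves b₁) (uniqueʳ i)

    part-unique : ∀ k → Unique (leaves (part k))
    part-unique true  = proj₁ parts-unique
    part-unique false = proj₁ (proj₂ parts-unique)

    bk-unique : ∀ k → Unique (leaves (b k))
    bk-unique true  = proj₁ b-unique
    bk-unique false = proj₁ (proj₂ b-unique)

    part-eval : ∀ k α → eval a α ⊑ eval (part k) α
    part-eval k α p = trans (sym (es k α)) (eval-mono a (λ {y} _ → keep-⊑ k α y) p)

    inference : ∀ k → Inference (part k) (b k)
    inference k = record
      { unique = part-unique k
      -- Both sides carry exactly the variables of a that have colour k.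
      ; same   = set⇒↭ (part-unique k) (bk-unique k)
                   (λ x∈ → ∈-b (∈a k x∈) (ms k x∈))
                   (λ x∈ → ∈part k (b∈ k x∈) (colour-b k x∈))
      ; entails = λ α p →
          trans (sym (Mono-eval (b k) (colour-b k) α)) (valid-b k (trans (es k α) p))
      ; nontrivial = λ { {x} x∈ tr → nontrivial i (∈a k x∈) (trivial x λ {α} {β} off p →
          ≡.subst (λ k → eval (b k) β ≡ true) (sym (ms k x∈)) (tr off (part-eval k α p))) }
      }

split-lhs : ∀ {n a₁ a₂ b} → Below n → size b ≤ n → Inference (a₁ ⊔ a₂) b → a₁ ⊔ a₂ ⟶ b
split-lhs {a₁ = a₁} {a₂} {b} ih b≤n i =
  ≡.subst₂ _⟶_ (dual-involutive (a₁ ⊔ a₂)) (dual-involutive b)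
    (dual-⟶ (split-rhs ih (≡.subst (_≤ _) (cong length (sym (leaves-dual b))) b≤n)
      (dual-inference i)))

-- A single variable as a conjunct on the left

-- In peeled, t′ is t[⊤/x]; in lost, t[⊤/x] does not depend on y.
data Peel (x : ℕ) (t : Tree) : Set where
  whole  : t ≡ leaf x → Peel x t
  peeled : ∀ t′ → leaf x ⊓ t′ ⟶ t → (∀ {α} → α x ≡ true → eval t α ≡ eval t′ α) → Peel x t
  lost   : ∀ y → y ∈ leaves t → y ≢ x →
           (∀ {α β} → Off y α β → α x ≡ true → eval t α ⊑ eval t β) → Peel x t

peel-comm : ∀ {c a b x} → Peel x (node c a b) → Peel x (node c b a)
peel-comm {c} {a} {b} (peeled t r e) =
  peeled t (r ◅◅ ac (≃-comm c a b)) λ {α} αx → trans (⟪⟫-comm c (eval b α) (eval a α)) (e αx)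
peel-comm {c} {a} {b} (lost y y∈ y≢x l) =
  lost y (∈-resp-↭ (++-comm (leaves a) (leaves b)) y∈) y≢x λ {α} {β} off αx →
    ≡.subst₂ _⊑_ (⟪⟫-comm c _ (eval b α)) (⟪⟫-comm c _ (eval b β)) (l off αx)

-- At a disjunction, switch lets the x in front pass into the disjunct that contains it. If that
-- disjunct is x itself, setting x to ⊤ makes the disjunction true and loses the variables of the
-- other disjunct.
peel-left : ∀ c {a b x} → x ∈ leaves a → Disjoint (leaves a) (leaves b) →
  Peel x a → Peel x (node c a b)
peel-left conj {b = b} x∈a d (whole refl) =
  peeled b ε λ {α} αx → cong (Bool._∧ eval b α) αx
peel-left disj {b = b} x∈a d (whole refl) =
  let y , y∈b = some-leaf b
      y≢x = λ { refl → d (x∈a , y∈b) } in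
  lost y (there y∈b) y≢x λ {α} {β} off αx _ →
    ∨-introˡ (eval b β) (trans (sym (off (≢-sym y≢x))) αx)
peel-left conj {b = b} x∈a d (peeled t r e) =
  peeled (t ⊓ b) (ac (≃-sym (≃-assoc conj _ t b)) ◅◅ ⟶-cong conj r ε)
    λ {α} αx → cong (Bool._∧ eval b α) (e αx)
peel-left disj {b = b} x∈a d (peeled t r e) =
  peeled (t ⊔ b) (step (sw _ t b) ◅◅ ⟶-cong disj r ε)
    λ {α} αx → cong (Bool._∨ eval b α) (e αx)
peel-left c {b = b} x∈a d (lost y y∈a y≢x l) =
  lost y (∈-++⁺ˡ y∈a) y≢x λ {α} {β} off αx →
    ⟪⟫-mono c (l off αx)
      (trans (sym (eval-cong b λ z∈b → off λ { refl → d (y∈a , z∈b) })))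

peel : ∀ {x} t → Unique (leaves t) → x ∈ leaves t → Peel x t
peel (leaf x)     u (here refl) = whole refl
peel (node c a b) u x∈ with unique-++⁻ (leaves a) u | ∈-++⁻ (leaves a) x∈
... | uᵃ , uᵇ , d | inj₁ x∈a = peel-left c x∈a d (peel a uᵃ x∈a)
... | uᵃ , uᵇ , d | inj₂ x∈b = peel-comm (peel-left c x∈b (d ∘ swap) (peel b uᵇ x∈b))

peel-inference : ∀ {n x a b} → Below n → size a < n → Inference (leaf x ⊓ a) b →
  leaf x ⊓ a ⟶ b
peel-inference {n} {x} {a} {b} ih a<n i =
  go (peel b (uniqueʳ i) (∈-resp-↭ (same i) (here refl)))
  where
  x∉a : x ∉ leaves a
  x∉a x∈a = proj₂ (proj₂ (unique-++⁻ (x ∷ []) (unique i))) (here refl , x∈a)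

  go : Peel x b → leaf x ⊓ a ⟶ b
  go (whole refl) = ⊥-elim (n≮0 (≡.subst (0 <_) (suc-injective (↭-length (same i))) (size>0 a)))
  go (lost y y∈b y≢x l) =
    ⊥-elim (nontrivial i (∈-resp-↭ (↭-sym (same i)) y∈b) λ {α} off p →
      l off (proj₁ (∧-elim {α x} p)) (entails i α p))
  go (peeled t r e) = ⟶-cong conj ε (ih a<n inference) ◅◅ r
    where
    a↭t : leaves a ↭ leaves t
    a↭t = drop-∷ (↭-trans (same i) (↭-sym (⟶-leaves r)))

    inference : Inference a t
    inference = record
      { unique = proj₁ (proj₂ (unique-++⁻ (x ∷ []) (unique i)))
      ; same   = a↭t
      ; entails = λ α p →
          -- The given entailment is used at α with x set to ⊤; this changes neither side, as x
          -- occurs in neither a nor t.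
          let α′ = λ y → if does (y ≟ x) then true else α y
              α′x = cong (if_then true else α x) (dec-true (x ≟ x) refl)
              off : Off x α α′
              off {y} y≢x = sym (cong (if_then true else α y) (dec-false (y ≟ x) y≢x))
              on : ∀ {u} → x ∉ leaves u → eval u α ≡ eval u α′
              on {u} x∉u = eval-cong u λ y∈u → off λ { refl → x∉u y∈u } in
          trans (on {t} (x∉a ∘ ∈-resp-↭ (↭-sym a↭t)))
            (trans (sym (e α′x))
              (entails i α′ (cong₂ Bool._∧_ α′x (trans (sym (on {a} x∉a)) p))))
      ; nontrivial = λ {y} y∈a tr → nontrivial i (there y∈a) λ {α} {β} off p →
          let αx , q = ∧-elim {α x} p
              x≢y = λ { refl → x∉a y∈a } in
          trans (e (trans (sym (off x≢y)) αx)) (tr off q)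
      }

-- The finite check

_≟ᶜ_ : (c d : Conn) → Dec (c ≡ d)
conj ≟ᶜ conj = yes refl
conj ≟ᶜ disj = no λ ()
disj ≟ᶜ conj = no λ ()
disj ≟ᶜ disj = yes refl

rooted : Conn → Tree → Bool
rooted c (leaf _)     = false
rooted c (node d _ _) = does (c ≟ᶜ d)

joins : List Tree → List Tree → List Tree
joins as rs = concatMap
  (λ c → cartesianProductWith (λ r a → node c a r) rs (filterᵇ (not ∘ rooted c) as))
  (conj ∷ disj ∷ [])

-- The trees obtained by splitting the list of labels at every node into two parts chosen by parts.
-- A left subtree never has the root connective of its parent, as in a list of conjuncts.
module _ (parts : List ℕ → List (List ℕ × List ℕ)) where

  trees : ℕ → List ℕ → List Tree
  trees (suc n) (x ∷ [])       = leaf x ∷ []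
  trees (suc n) xs@(_ ∷ _ ∷ _) =
    concatMap (λ (ys , zs) → joins (trees n ys) (trees n zs)) (parts xs)
  trees _       _              = []

breaks : List ℕ → List (List ℕ × List ℕ)
breaks []       = []
breaks (x ∷ xs) = (x ∷ [] , xs) ∷ map (λ (ys , zs) → x ∷ ys , zs) (breaks xs)

-- Left-hand sides matter only up to renaming, so their leaves may be labelled from left to right.
cuts : List ℕ → List (List ℕ × List ℕ)
cuts = filterᵇ (λ (ys , zs) → length ys ≤ᵇ length zs) ∘ breaks

divisions : List ℕ → List (List ℕ × List ℕ)
divisions []       = ([] , []) ∷ []
divisions (x ∷ xs) = map (λ (ys , zs) → x ∷ ys , zs) (divisions xs)
                  ++ map (λ (ys , zs) → ys , x ∷ zs) (divisions xs)

-- The first label goes to the left, which fixes the order of the two subtrees.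
picks : List ℕ → List (List ℕ × List ℕ)
picks []       = []
picks (x ∷ xs) = map (λ (ys , zs) → x ∷ ys , zs) (divisions xs)

-- The left-hand sides whose inferences come down to inferences with fewer variables.
data Reducible : Tree → Set where
  leaf : ∀ x → Reducible (leaf x)
  top  : ∀ x a → Reducible (leaf x ⊓ a)
  disj : ∀ a b → Reducible (a ⊔ b)

-- Only the subtrees within the top cluster of c are split off, not every set of components. An
-- omission could make the check fail but never make it unsound, since each entry carries its
-- equivalence.
splits : ∀ c t → List (∃₂ λ a r → t ≃ node c a r)
splits c (leaf _) = []
splits c (node d a b) with c ≟ᶜ d
... | no _     = []
... | yes refl =
  (a , b , ≃-refl) ∷ (b , a , ≃-comm c a b) ∷
  map (λ (a′ , r , e) → a′ , node c r b ,
        ≃-trans (≃-cong c e ≃-refl) (≃-assoc c a′ r b))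
    (splits c a) ++
  map (λ (b′ , r , e) → b′ , node c r a ,
        ≃-trans (≃-comm c a b) (≃-trans (≃-cong c e ≃-refl) (≃-assoc c b′ r a)))
    (splits c b)

immediate : ∀ t → List (∃ λ χ → t ≃ χ × Reducible χ)
immediate (leaf x) = (leaf x , ≃-refl , leaf x) ∷ []
immediate (a ⊔ b)  = (a ⊔ b , ≃-refl , disj a b) ∷ []
immediate (a ⊓ b)  = concatMap pick (splits conj (a ⊓ b))
  where
  pick : (∃₂ λ a′ r → a ⊓ b ≃ a′ ⊓ r) → List (∃ λ χ → a ⊓ b ≃ χ × Reducible χ)
  pick (leaf x , r , e)     = (leaf x ⊓ r , e , top x r) ∷ []
  pick (node _ _ _ , _ , _) = []

-- Each result carries its derivation and is a disjunction, hence reducible, so the search itself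
-- needs no correctness proof.
switches : ∀ t → List (∃ λ χ → t ⟶ χ × Reducible χ)
switches t = concatMap
  (λ (a , r , e) → map
    (λ (d , x , e′) → (r ⊓ x) ⊔ d ,
       ac (≃-trans e (≃-trans (≃-comm conj a r)
             (≃-cong conj ≃-refl (≃-trans e′ (≃-comm disj d x)))))
         ◅◅ step (sw r x d) ,
       disj (r ⊓ x) d)
    (splits disj a))
  (splits conj t)

_◂_ : Bool → Assignment → Assignment
(b ◂ α) zero    = b
(b ◂ α) (suc i) = α i

assignments : ℕ → List Assignment
assignments zero    = (λ _ → false) ∷ []
assignments (suc n) = map (false ◂_) (assignments n) ++ map (true ◂_) (assignments n)

models : ℕ → Tree → List Assignment
models n t = filterᵇ (eval t) (assignments n)

interval : ℕ → ℕ → List ℕ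
interval k zero    = []
interval k (suc n) = k ∷ interval (suc k) n

forwards : ∀ {φ} → ℕ → List (∃ λ χ → φ ⟶ χ × Reducible χ) → Tree → Bool
forwards n χs ψ = any (λ χ → all (eval ψ) (models n (proj₁ χ))) χs

-- A switch of `dual ψ` to χ is, read dually, a derivation of ψ from `dual χ`. With the models of φ
-- as `ms`, the test is that φ entails some such `dual χ`.
backwards : List Assignment → Tree → Bool
backwards ms ψ = any (λ χ → all (eval (dual (proj₁ χ))) ms) (switches (dual ψ))

-- The data depending on φ alone are passed as arguments so that they are computed only once.
test : ∀ {φ} → ℕ → List Assignment → List (∃ λ χ → φ ⟶ χ × Reducible χ) → Tree → Bool
test n ms χs ψ = not (all (eval ψ) ms) Bool.∨ (forwards n χs ψ Bool.∨ backwards ms ψ)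

checkAll : ℕ → List Tree → Bool
checkAll n ψs = all (λ φ → all (test n (models n φ) (switches φ)) ψs)
  (filterᵇ (null ∘ immediate) (trees cuts n (interval 0 n)))

check : ℕ → Bool
check n = checkAll n (filterᵇ (null ∘ immediate ∘ dual) (trees picks n (interval 0 n)))

-- Renaming

rename : (ℕ → ℕ) → Tree → Tree
rename f (leaf x)     = leaf (f x)
rename f (node c a b) = node c (rename f a) (rename f b)

leaves-rename : ∀ f t → leaves (rename f t) ≡ map f (leaves t)
leaves-rename f (leaf x)     = refl
leaves-rename f (node c a b) =
  trans (cong₂ _++_ (leaves-rename f a) (leaves-rename f b)) (sym (map-++ f (leaves a) (leaves b)))

eval-rename : ∀ f t α → eval (rename f t) α ≡ eval t (α ∘ f)
eval-rename f (leaf x)     α = refl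
eval-rename f (node c a b) α = cong₂ ⟪ c ⟫ (eval-rename f a α) (eval-rename f b α)

rename-inverse : ∀ {f g} t → (∀ {x} → x ∈ leaves t → g (f x) ≡ x) → rename g (rename f t) ≡ t
rename-inverse (leaf x)     h = cong leaf (h (here refl))
rename-inverse (node c a b) h = cong₂ (node c)
  (rename-inverse a (h ∘ ∈-++⁺ˡ)) (rename-inverse b (h ∘ ∈-++⁺ʳ (leaves a)))

dual-rename : ∀ f t → dual (rename f t) ≡ rename f (dual t)
dual-rename f (leaf x)     = refl
dual-rename f (node c a b) = cong₂ (node (flip c)) (dual-rename f a) (dual-rename f b)

rooted-rename : ∀ f c t → rooted c (rename f t) ≡ rooted c t
rooted-rename f c (leaf x)     = refl
rooted-rename f c (node d a b) = refl

rename-⊩ : ∀ f {a b} → a ⊩ b → rename f a ⊩ rename f b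
rename-⊩ f {a} {b} v α =
  ≡.subst₂ _⊑_ (sym (eval-rename f a α)) (sym (eval-rename f b α)) (v (α ∘ f))

rename-≃ : ∀ f {a b} → a ≃ b → rename f a ≃ rename f b
rename-≃ f ≃-refl            = ≃-refl
rename-≃ f (≃-sym e)         = ≃-sym (rename-≃ f e)
rename-≃ f (≃-trans e e′)    = ≃-trans (rename-≃ f e) (rename-≃ f e′)
rename-≃ f (≃-cong c e e′)   = ≃-cong c (rename-≃ f e) (rename-≃ f e′)
rename-≃ f (≃-comm c a b)    = ≃-comm c _ _
rename-≃ f (≃-assoc c a b d) = ≃-assoc c _ _ _

rename-⊸ : ∀ f {a b} → a ⊸ b → rename f a ⊸ rename f b
rename-⊸ f (sw x y z)    = sw _ _ _
rename-⊸ f (md w x y z)  = md _ _ _ _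
rename-⊸ f (left c b s)  = left c _ (rename-⊸ f s)
rename-⊸ f (right c a s) = right c _ (rename-⊸ f s)

rename-⟶ : ∀ f {a b} → a ⟶ b → rename f a ⟶ rename f b
rename-⟶ f = gmap (rename f) [ inj₁ ∘ rename-≃ f , inj₂ ∘ rename-⊸ f ]′

rename-reducible : ∀ f {t} → Reducible t → Reducible (rename f t)
rename-reducible f (leaf x)   = leaf _
rename-reducible f (top x a)  = top _ _
rename-reducible f (disj a b) = disj _ _

Advances : Tree → Tree → Set
Advances φ ψ = ∃ λ χ → φ ⟶ χ × Reducible χ × χ ⊩ ψ

Progress : Tree → Tree → Set
Progress φ ψ = Advances φ ψ ⊎ Advances (dual ψ) (dual φ)

rename-advances : ∀ f {φ ψ} → Advances φ ψ → Advances (rename f φ) (rename f ψ)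
rename-advances f {ψ = ψ} (χ , r , h , v) =
  rename f χ , rename-⟶ f r , rename-reducible f h , rename-⊩ f {χ} {ψ} v

rename-progress : ∀ f {φ ψ} → Progress φ ψ → Progress (rename f φ) (rename f ψ)
rename-progress f {φ} {ψ} (inj₁ h) = inj₁ (rename-advances f {φ} {ψ} h)
rename-progress f {φ} {ψ} (inj₂ h) =
  inj₂ (≡.subst₂ Advances (sym (dual-rename f ψ)) (sym (dual-rename f φ))
    (rename-advances f {dual ψ} {dual φ} h))

∈-interval : ∀ {x} k n → x ∈ interval k n → k ≤ x × x < k + n
∈-interval k (suc n) (here refl) = ≤-refl , ≡.subst (k <_) (sym (+-suc k n)) (s≤s (m≤m+n k n))
∈-interval {x} k (suc n) (there x∈) =
  let k<x , x<k+n = ∈-interval (suc k) n x∈ in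
  <⇒≤ k<x , ≡.subst (x <_) (sym (+-suc k n)) x<k+n

-- It suffices that ρ inverts π on xs: renaming back is only applied to trees whose leaves come from
-- xs.
number : ∀ k xs → Unique xs → ∃₂ λ (π ρ : ℕ → ℕ) →
  map π xs ≡ interval k (length xs) × (∀ {x} → x ∈ xs → ρ (π x) ≡ x)
number k []       u        = id , id , refl , λ ()
number k (x ∷ xs) (x∉ ∷ u) with number (suc k) xs u
... | π , ρ , πxs , inv =
  π′ , ρ′ , cong₂ _∷_ π′x (trans (map-cong-local (All.map π′y x∉)) πxs) , inv′
  where
  π′ = λ y → if does (y ≟ x) then k else π y
  ρ′ = λ i → if does (i ≟ k) then x else ρ i

  π′x : π′ x ≡ k
  π′x = cong (if_then k else π x) (dec-true (x ≟ x) refl)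

  π′y : ∀ {y} → x ≢ y → π′ y ≡ π y
  π′y {y} x≢y = cong (if_then k else π y) (dec-false (y ≟ x) (≢-sym x≢y))

  inv′ : ∀ {y} → y ∈ x ∷ xs → ρ′ (π′ y) ≡ y
  inv′ (here refl) = trans (cong ρ′ π′x) (cong (if_then x else ρ k) (dec-true (k ≟ k) refl))
  inv′ {y} (there y∈) =
    trans (cong ρ′ (π′y (All.lookup x∉ y∈)))
      (trans (cong (if_then x else ρ (π y)) (dec-false (π y ≟ k) πy≢k)) (inv y∈))
    where
    πy≢k : π y ≢ k
    πy≢k = ≢-sym (<⇒≢ (proj₁
      (∈-interval (suc k) (length xs) (≡.subst (π y ∈_) πxs (∈-map⁺ π y∈)))))

-- Completeness of the enumeration

-- Normalising a left subtree thus respects the restriction that `joins` puts on its root.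
≃-rooted : ∀ c {a b} → a ≃ b → rooted c a ≡ rooted c b
≃-rooted c ≃-refl            = refl
≃-rooted c (≃-sym e)         = sym (≃-rooted c e)
≃-rooted c (≃-trans e f)     = trans (≃-rooted c e) (≃-rooted c f)
≃-rooted c (≃-cong d e f)    = refl
≃-rooted c (≃-comm d a b)    = refl
≃-rooted c (≃-assoc d a b t) = refl

≃-size : ∀ {a b} → a ≃ b → size a ≡ size b
≃-size e = ↭-length (≃-leaves e)

size-node : ∀ c a b → size (node c a b) ≡ size a + size b
size-node c a b = length-++ (leaves a)

size-left : ∀ c a b → size a < size (node c a b)
size-left c a b = ≡.subst (size a <_) (sym (size-node c a b)) (m<m+n _ (size>0 b))

size-right : ∀ c a b → size b < size (node c a b)
size-right c a b = ≡.subst (size b <_) (sym (size-node c a b)) (m<n+m _ (size>0 a))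

parts-≤ : ∀ {n c t a r} → t ≃ node c a r → size t ≤ suc n → size a ≤ n × size r ≤ n
parts-≤ {n} {c} {_} {a} {r} e p =
  let q = ≡.subst (_≤ suc n) (≃-size e) p in
  ≤-pred (≤-trans (size-left c a r) q) , ≤-pred (≤-trans (size-right c a r) q)

module _ (P : Tree → Tree → Set) (c : Conn)
  (step : ∀ a b t → P (node c a b) t → P a (node c b t) ⊎ P b (node c a t)) where

  -- P relates the component still held to the remainder, and `step` tells which of its two pieces
  -- to follow. The descent ends at a component not rooted in c.
  detach : ∀ a t → P a t →
    ∃₂ λ a′ r → node c a t ≃ node c a′ r × rooted c a′ ≡ false × P a′ r
  detach (leaf x)     t p = leaf x , t , ≃-refl , refl , p
  detach (node d a b) t p with c ≟ᶜ d in eq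
  ... | no c≢d   = node d a b , t , ≃-refl , cong does eq , p
  ... | yes refl with step a b t p
  ...   | inj₁ q = let a′ , r , e , s = detach a (node c b t) q in
                   a′ , r , ≃-trans (≃-assoc c a b t) e , s
  ...   | inj₂ q = let a′ , r , e , s = detach b (node c a t) q in
                   a′ , r ,
                   ≃-trans (≃-trans (≃-cong c (≃-comm c a b) ≃-refl) (≃-assoc c b a t)) e , s

detach-small : ∀ c a b →
  ∃₂ λ a′ r → node c a b ≃ node c a′ r × rooted c a′ ≡ false × size a′ ≤ size r
detach-small c a b = [ detach P c shrink a b , from-right ]′ (≤-total (size a) (size b))
  where
  P : Tree → Tree → Set
  P a b = size a ≤ size b

  shrink : ∀ a b t → size (node c a b) ≤ size t →
    size a ≤ size (node c b t) ⊎ size b ≤ size (node c a t)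
  shrink a b t p = inj₁ (≤-trans (<⇒≤ (size-left c a b)) (≤-trans p (<⇒≤ (size-right c b t))))

  from-right : size b ≤ size a → _
  from-right p = let a′ , r , e , s = detach P c shrink b a p in
    a′ , r , ≃-trans (≃-comm c a b) e , s

detach-at : ∀ {x} c a b → x ∈ leaves (node c a b) →
  ∃₂ λ a′ r → node c a b ≃ node c a′ r × rooted c a′ ≡ false × x ∈ leaves a′
detach-at {x} c a b x∈ = [ detach P c narrow a b , from-right ]′ (∈-++⁻ (leaves a) x∈)
  where
  P : Tree → Tree → Set
  P a _ = x ∈ leaves a

  narrow : ∀ a b (t : Tree) → x ∈ leaves (node c a b) → x ∈ leaves a ⊎ x ∈ leaves b
  narrow a b t = ∈-++⁻ (leaves a)

  from-right : x ∈ leaves b → _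
  from-right p = let a′ , r , e , s = detach P c narrow b a p in
    a′ , r , ≃-trans (≃-comm c a b) e , s

∈-filterᵇ : ∀ {A : Set} {p : A → Bool} {x xs} → x ∈ xs → p x ≡ true → x ∈ filterᵇ p xs
∈-filterᵇ {p = p} x∈ px = ∈-filter⁺ (T? ∘ p) x∈ (Equivalence.from T-≡ px)

∈-trees : ∀ parts {n xs ys zs} c {a r} → 1 < length xs → (ys , zs) ∈ parts xs →
  a ∈ trees parts n ys → rooted c a ≡ false → r ∈ trees parts n zs →
  node c a r ∈ trees parts (suc n) xs
∈-trees parts {n} {_ ∷ _ ∷ _} {ys} {zs} c _ part a∈ rt r∈ =
  ∈-concatMap⁺ (λ (ys , zs) → joins (trees parts n ys) (trees parts n zs)) (lose part
    (∈-concatMap⁺ (λ c → cartesianProductWith (λ r a → node c a r) (trees parts n zs)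
        (filterᵇ (not ∘ rooted c) (trees parts n ys)))
      (lose (conn c) (∈-cartesianProductWith⁺ (λ r a → node c a r) r∈
        (∈-filterᵇ {p = not ∘ rooted c} a∈ (cong not rt))))))
  where
  conn : ∀ c → c ∈ conj ∷ disj ∷ []
  conn conj = here refl
  conn disj = there (here refl)
∈-trees _ {xs = []}     _ ()
∈-trees _ {xs = _ ∷ []} _ (s≤s ())

∈-cuts : ∀ {ys zs} → 0 < length ys → length ys ≤ length zs → (ys , zs) ∈ cuts (ys ++ zs)
∈-cuts {y ∷ ys} {zs} _ p =
  ∈-filterᵇ {p = λ (ys , zs) → length ys ≤ᵇ length zs}
    (∈-breaks y ys) (Equivalence.to T-≡ (≤⇒≤ᵇ p))
  where
  ∈-breaks : ∀ y ys → (y ∷ ys , zs) ∈ breaks (y ∷ ys ++ zs)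
  ∈-breaks y []        = here refl
  ∈-breaks y (y′ ∷ ys) = there (∈-map⁺ _ (∈-breaks y′ ys))

node-size>1 : ∀ c a b → 1 < size (node c a b)
node-size>1 c a b = ≤-trans (s≤s (size>0 a)) (size-left c a b)

-- The labelling f is quantified after t′ because the numbering of the leaves can only be chosen
-- once their order in t′ is known.
∈-shapes : ∀ n t → size t ≤ n →
  ∃ λ t′ → t ≃ t′ × (∀ f → rename f t′ ∈ trees cuts n (map f (leaves t′)))
∈-shapes (suc n) (leaf x)     p = leaf x , ≃-refl , λ f → here refl
∈-shapes zero    t            p = ⊥-elim (n≮0 (≤-trans (size>0 t) p))
∈-shapes (suc n) (node c a b) p with detach-small c a b
... | a′ , r , e , rt , a′≤r
  with ∈-shapes n a′ (proj₁ (parts-≤ e p))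
     | ∈-shapes n r (proj₂ (parts-≤ e p))
... | a″ , ea , a∈ | r″ , er , r∈ =
  node c a″ r″ , ≃-trans e (≃-cong c ea er) , λ f →
    let la = map f (leaves a″)
        lr = map f (leaves r″)
        sa = length-map f (leaves a″)
        sr = length-map f (leaves r″) in
    ≡.subst (λ xs → node c (rename f a″) (rename f r″) ∈ trees cuts (suc n) xs)
      (sym (map-++ f (leaves a″) (leaves r″)))
      (∈-trees cuts {xs = la ++ lr} c
        (≡.subst (1 <_)
          (trans (size-node c a″ r″) (trans (sym (cong₂ _+_ sa sr)) (sym (length-++ la))))
          (node-size>1 c a″ r″))
        (∈-cuts (≡.subst (0 <_) (sym sa) (size>0 a″))
          (≡.subst₂ _≤_ (trans (≃-size ea) (sym sa)) (trans (≃-size er) (sym sr)) a′≤r))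
        (a∈ f) (trans (rooted-rename f c a″) (trans (sym (≃-rooted c ea)) rt)) (r∈ f))

extract : ∀ {x : ℕ} {xs} → x ∈ xs → ∃ λ ys → xs ↭ x ∷ ys
extract {x} x∈ with ys , zs , refl ← ∈-∃++ x∈ = ys ++ zs , shift x ys zs

-- `divisions` keeps the order of xs in both halves, so a given division is met only up to a
-- permutation of each half.
∈-divisions : ∀ xs {as bs} → as ++ bs ↭ xs →
  ∃₂ λ ys zs → (ys , zs) ∈ divisions xs × as ↭ ys × bs ↭ zs
∈-divisions [] {as} {bs} p with ↭-empty-inv p
... | eq =
  [] , [] , here refl , ↭-reflexive (++-conicalˡ as bs eq) , ↭-reflexive (++-conicalʳ as bs eq)
∈-divisions (x ∷ xs) {as} {bs} p with ∈-++⁻ as (∈-resp-↭ (↭-sym p) (here refl))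
... | inj₁ x∈ =
  let as′ , q = extract x∈
      ys , zs , ∈d , qa , qb = ∈-divisions xs {as′} (drop-∷ (↭-trans (++⁺ʳ bs (↭-sym q)) p)) in
  x ∷ ys , zs , ∈-++⁺ˡ (∈-map⁺ _ ∈d) , ↭-trans q (↭-prep x qa) , qb
... | inj₂ x∈ =
  let bs′ , q = extract x∈
      ys , zs , ∈d , qa , qb = ∈-divisions xs {as}
        (drop-∷ (↭-trans (↭-sym (↭-trans (++⁺ˡ as q) (shift x as bs′))) p)) in
  ys , x ∷ zs , ∈-++⁺ʳ _ (∈-map⁺ _ ∈d) , qa , ↭-trans q (↭-prep x qb)

-- The component holding the first label of xs is brought to the left, as `picks` demands; the rest
-- of the labels may be divided in any way.
∈-forms : ∀ n t {xs} → leaves t ↭ xs → size t ≤ n →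
  ∃ λ t′ → t ≃ t′ × t′ ∈ trees picks n xs
∈-forms zero    t            q p = ⊥-elim (n≮0 (≤-trans (size>0 t) p))
∈-forms (suc n) (leaf x)     q p rewrite ↭-singleton-inv (↭-sym q) = leaf x , ≃-refl , here refl
∈-forms (suc n) (node c a b) {[]}     q p =
  ⊥-elim (n≮0 (≡.subst (0 <_) (↭-length q) (size>0 (node c a b))))
∈-forms (suc n) (node c a b) {x ∷ xs} q p
  with detach-at c a b (∈-resp-↭ (↭-sym q) (here refl))
... | a′ , r , e , rt , x∈a′ with extract x∈a′
... | as , qa with ∈-divisions xs {as} {leaves r}
    (drop-∷ (↭-trans (++⁺ʳ (leaves r) (↭-sym qa)) (↭-trans (↭-sym (≃-leaves e)) q)))
... | ys , zs , ∈d , qy , qz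
  with ∈-forms n a′ (↭-trans qa (↭-prep x qy)) (proj₁ (parts-≤ e p))
     | ∈-forms n r qz (proj₂ (parts-≤ e p))
... | a″ , ea , a∈ | r″ , er , r∈ =
  node c a″ r″ , ≃-trans e (≃-cong c ea er) ,
  ∈-trees picks {xs = x ∷ xs} c (≡.subst (1 <_) (↭-length q) (node-size>1 c a b))
    (∈-map⁺ _ ∈d) a∈ (trans (sym (≃-rooted c ea)) rt) r∈

-- Soundness of the check

T-true : ∀ {b} → b ≡ true → T b
T-true = Equivalence.from T-≡

-- Agreement holds only below n, since every listed assignment is false from n on.
assignments-complete : ∀ n (α : Assignment) → ∃ λ (β : Assignment) →
  β ∈ assignments n × (∀ {i} → i < n → α i ≡ β i)
assignments-complete zero    α = _ , here refl , λ ()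
assignments-complete (suc n) α with assignments-complete n (α ∘ suc) | α 0 in eq
... | β , β∈ , h | b = b ◂ β , ∈b b , λ { {zero} _ → eq ; {suc i} (s≤s p) → h p }
  where
  ∈b : ∀ b → b ◂ β ∈ assignments (suc n)
  ∈b false = ∈-++⁺ˡ (∈-map⁺ (false ◂_) β∈)
  ∈b true  = ∈-++⁺ʳ _ (∈-map⁺ (true ◂_) β∈)

models-complete : ∀ n {a b} → a ⊩ b → T (all (eval b) (models n a))
models-complete n {a} {b} v = All.all⁻ (eval b)
  (All.map (λ p → T-true (v _ (Equivalence.to T-≡ p)))
    (All.all-filter (T? ∘ eval a) (assignments n)))

models-sound : ∀ n {a b} → (∀ {x} → x ∈ leaves a → x < n) → (∀ {x} → x ∈ leaves b → x < n) →
  T (all (eval b) (models n a)) → a ⊩ b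
models-sound n {a} {b} a<n b<n p α q =
  let β , β∈ , h = assignments-complete n α in
  trans (eval-cong b λ x∈ → h (b<n x∈)) (Equivalence.to T-≡
    (All.lookup (All.all⁺ (eval b) (models n a) p)
      (∈-filterᵇ {p = eval a} β∈ (trans (sym (eval-cong a λ x∈ → h (a<n x∈))) q))))

first : ∀ {A : Set} (xs : List A) → null xs ≡ false → A
first (x ∷ _) _ = x

check-sound : ∀ n {φ ψ} → check n ≡ true →
  φ ∈ trees cuts n (interval 0 n) → ψ ∈ trees picks n (interval 0 n) →
  (∀ {x} → x ∈ leaves φ → x < n) → leaves φ ↭ leaves ψ → φ ⊩ ψ → Progress φ ψ
check-sound n {φ} {ψ} ok φ∈ ψ∈ φ<n same v = go _ refl _ refl
  where
  ψs = filterᵇ (null ∘ immediate ∘ dual) (trees picks n (interval 0 n))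
  φs = filterᵇ (null ∘ immediate) (trees cuts n (interval 0 n))
  ms = models n φ

  ψ<n : ∀ {x} → x ∈ leaves ψ → x < n
  ψ<n = φ<n ∘ ∈-resp-↭ (↭-sym same)

  tested : null (immediate φ) ≡ true → null (immediate (dual ψ)) ≡ true →
    T (test n ms (switches φ) ψ)
  tested p q =
    All.lookup (All.all⁺ (test n ms (switches φ)) ψs
      (All.lookup (All.all⁺ (λ φ → all (test n (models n φ) (switches φ)) ψs) φs (T-true ok))
        (∈-filterᵇ {p = null ∘ immediate} φ∈ p)))
      (∈-filterᵇ {p = null ∘ immediate ∘ dual} ψ∈ q)

  valid-switch : ∀ b {b′} → T b → T (not b Bool.∨ b′) → T b′
  valid-switch true _ p = p

  forward : T (forwards n (switches φ) ψ) → Advances φ ψ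
  forward p with find (Any.any⁻ _ (switches φ) p)
  ... | (χ , r , h) , _ , q =
    χ , r , h , models-sound n {χ} {ψ} (φ<n ∘ ∈-resp-↭ (↭-sym (⟶-leaves r))) ψ<n q

  backward : T (backwards ms ψ) → Advances (dual ψ) (dual φ)
  backward p with find (Any.any⁻ _ (switches (dual ψ)) p)
  ... | (χ , r , h) , _ , q =
    χ , r , h , ≡.subst (_⊩ dual φ) (dual-involutive χ)
      (dual-⊩ {φ} {dual χ} (models-sound n {φ} {dual χ} φ<n χ<n q))
    where
    χ<n : ∀ {x} → x ∈ leaves (dual χ) → x < n
    χ<n x∈ = ψ<n (≡.subst (_ ∈_) (leaves-dual ψ)
      (∈-resp-↭ (↭-sym (⟶-leaves r)) (≡.subst (_ ∈_) (leaves-dual χ) x∈)))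

  go : ∀ b → null (immediate φ) ≡ b → ∀ b′ → null (immediate (dual ψ)) ≡ b′ → Progress φ ψ
  -- A left-hand side left out of the check is already reducible up to `≃`.
  go false p _ _ = let χ , e , h = first (immediate φ) p in
    inj₁ (χ , ac e , h , λ α → v α ∘ trans (≃-eval e α))
  go true p false q = let χ , e , h = first (immediate (dual ψ)) q in
    inj₂ (χ , ac e , h , λ α → dual-⊩ {φ} {ψ} v α ∘ trans (≃-eval e α))
  go true p true q =
    [ inj₁ ∘ forward , inj₂ ∘ backward ]′ (Equivalence.to (T-∨ {forwards n (switches φ) ψ})
      (valid-switch (all (eval ψ) ms) (models-complete n {φ} {ψ} v) (tested p q)))

advances-resp-≃ : ∀ {φ φ′ ψ ψ′} → φ ≃ φ′ → ψ ≃ ψ′ → Advances φ′ ψ′ → Advances φ ψ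
advances-resp-≃ e e′ (χ , r , h , v) =
  χ , ac e ◅◅ r , h , λ α → trans (≃-eval e′ α) ∘ v α

-- The numbering π is read off from the normal form of φ, so that its leaves become 0, 1, ... from
-- left to right; ψ is renamed along with it and normalised afterwards. The outcome of the check is
-- a hypothesis here, so it is evaluated only in `check-7` and `checked`.
progress : (∀ {n} → n < 8 → check n ≡ true) → ∀ {φ ψ} → size φ < 8 → Unique (leaves φ) →
  leaves φ ↭ leaves ψ → φ ⊩ ψ → Progress φ ψ
progress ok {φ} {ψ} φ<8 u same v with ∈-shapes (size φ) φ ≤-refl
... | φ′ , e , shape with number 0 (leaves φ′) (Unique-resp-↭ (≃-leaves e) u)
... | π , ρ , πφ′ , inv with ∈-forms (size φ) (rename π ψ) {interval 0 (size φ)}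
        (≡.subst₂ _↭_ (sym (leaves-rename π ψ)) (trans πφ′ (cong (interval 0) (sym (≃-size e))))
          (Permutation.map⁺ π (↭-trans (↭-sym same) (≃-leaves e))))
        (≤-reflexive (trans (cong length (leaves-rename π ψ))
          (trans (length-map π (leaves ψ)) (sym (↭-length same)))))
... | ψ₀ , e₀ , form =
  transport (≡.subst (λ t → Progress t (rename ρ ψ₀)) (rename-inverse φ′ inv)
    (rename-progress ρ {φ₀} {ψ₀} progress₀))
  where
  φ₀ = rename π φ′
  n = size φ

  labels : map π (leaves φ′) ≡ interval 0 n
  labels = trans πφ′ (cong (interval 0) (sym (≃-size e)))

  φ₀⊩ψ₀ : φ₀ ⊩ ψ₀
  φ₀⊩ψ₀ α =
    trans (sym (≃-eval e₀ α)) ∘ rename-⊩ π {φ′} {ψ} (λ α → v α ∘ trans (≃-eval e α)) α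

  same₀ : leaves φ₀ ↭ leaves ψ₀
  same₀ = ↭-trans (≡.subst₂ _↭_ (sym (leaves-rename π φ′)) (sym (leaves-rename π ψ))
    (Permutation.map⁺ π (↭-trans (↭-sym (≃-leaves e)) same))) (≃-leaves e₀)

  progress₀ : Progress φ₀ ψ₀
  progress₀ = check-sound n (ok φ<8) (≡.subst (λ xs → φ₀ ∈ trees cuts n xs) labels (shape π)) form
    (λ {x} x∈ → proj₂ (∈-interval 0 n (≡.subst (x ∈_) (trans (leaves-rename π φ′) labels) x∈)))
    same₀ φ₀⊩ψ₀

  ψ≃ : ψ ≃ rename ρ ψ₀
  ψ≃ = ≡.subst (_≃ rename ρ ψ₀)
    (rename-inverse ψ λ x∈ → inv (∈-resp-↭ (↭-trans (↭-sym same) (≃-leaves e)) x∈))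
    (rename-≃ ρ e₀)

  transport : Progress φ′ (rename ρ ψ₀) → Progress φ ψ
  transport (inj₁ h) = inj₁ (advances-resp-≃ {ψ = ψ} e ψ≃ h)
  transport (inj₂ h) = inj₂ (advances-resp-≃ {ψ = dual φ} (dual-≃ ψ≃) (dual-≃ e) h)

-- Induction on the number of variables

reduce : ∀ {n χ ψ} → Below n → size χ ≤ n → Reducible χ → Inference χ ψ → χ ⟶ ψ
reduce {ψ = ψ} ih χ≤n (leaf x) i = leaf-only ψ (same i)
  where
  leaf-only : ∀ ψ → x ∷ [] ↭ leaves ψ → leaf x ⟶ ψ
  leaf-only (leaf y) p with refl ← ↭-singleton-inv p = ε
  leaf-only (node c a b) p = ⊥-elim (<-irrefl (↭-length p) (node-size>1 c a b))
reduce ih χ≤n (top x a)  i = peel-inference ih (≤-trans (size-right conj (leaf x) a) χ≤n) i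
reduce {ψ = ψ} ih χ≤n (disj a b) i =
  split-lhs ih (≤-trans (≤-reflexive (sym (↭-length (same i)))) χ≤n) i

-- `progress` keeps the number of variables; the descent happens in `reduce`, which uses the
-- induction hypothesis on proper parts.
below : (∀ {n} → n < 8 → check n ≡ true) → ∀ n → n ≤ 8 → Below n
below ok zero    n≤8 ()
below ok (suc n) n≤8 {φ} {ψ} (s≤s φ≤n) i =
  [ forward , backward ]′
    (progress ok {φ} {ψ} (≤-trans (s≤s φ≤n) n≤8) (unique i) (same i) (entails i))
  where
  ih : Below n
  ih = below ok n (<⇒≤ n≤8)

  size-≤ : ∀ {a b} → a ⟶ b → size a ≤ n → size b ≤ n
  size-≤ r = ≡.subst (_≤ n) (↭-length (⟶-leaves r))

  forward : Advances φ ψ → φ ⟶ ψ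
  forward (χ , r , h , v) = r ◅◅ reduce ih (size-≤ r φ≤n) h (advance r v i)

  backward : Advances (dual ψ) (dual φ) → φ ⟶ ψ
  backward (χ , r , h , v) = ≡.subst₂ _⟶_ (dual-involutive φ) (dual-involutive ψ) (dual-⟶
    (r ◅◅ reduce ih
      (≡.subst (_≤ n) (trans (↭-length (same i))
        (trans (cong length (sym (leaves-dual ψ))) (↭-length (⟶-leaves r)))) φ≤n)
      h (advance r v (dual-inference i))))

-- Trees as formulae

⌊_⌋ : Tree → Formula
⌊ leaf x ⌋ = var x
⌊ a ⊓ b ⌋  = ⌊ a ⌋ ∧ ⌊ b ⌋
⌊ a ⊔ b ⌋  = ⌊ a ⌋ ∨ ⌊ b ⌋

tree : ∀ {φ} → ConstantFree φ → NegationFree φ → ∃ λ t → φ ≡ ⌊ t ⌋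
tree (var x) (var x) = leaf x , refl
tree (c ∧ d) (m ∧ n) with tree c m | tree d n
... | a , refl | b , refl = a ⊓ b , refl
tree (c ∨ d) (m ∨ n) with tree c m | tree d n
... | a , refl | b , refl = a ⊔ b , refl

LinearOn⇒↭ : ∀ t {V} → ⌊ t ⌋ LinearOn V → V ↭ leaves t
LinearOn⇒↭ (leaf x) (var-on x)     = ↭-refl
LinearOn⇒↭ (a ⊓ b)  (∧-on l m d p) = ↭-trans p (++⁺ (LinearOn⇒↭ a l) (LinearOn⇒↭ b m))
LinearOn⇒↭ (a ⊔ b)  (∨-on l m d p) = ↭-trans p (++⁺ (LinearOn⇒↭ a l) (LinearOn⇒↭ b m))

LinearOn⇒Unique : ∀ {φ V} → φ LinearOn V → Unique V
LinearOn⇒Unique ⊤-on           = []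
LinearOn⇒Unique ⊥-on           = []
LinearOn⇒Unique (var-on x)     = [] ∷ []
LinearOn⇒Unique (¬var-on x)    = [] ∷ []
LinearOn⇒Unique (∧-on l m d p) =
  Unique-resp-↭ (↭-sym p) (Unique.++⁺ (LinearOn⇒Unique l) (LinearOn⇒Unique m) d)
LinearOn⇒Unique (∨-on l m d p) =
  Unique-resp-↭ (↭-sym p) (Unique.++⁺ (LinearOn⇒Unique l) (LinearOn⇒Unique m) d)

linear : ∀ t → Unique (leaves t) → ⌊ t ⌋ LinearOn leaves t
linear (leaf x) u = var-on x
linear (a ⊓ b)  u =
  let v , w , d = unique-++⁻ (leaves a) u in ∧-on (linear a v) (linear b w) d ↭-refl
linear (a ⊔ b)  u =
  let v , w , d = unique-++⁻ (leaves a) u in ∨-on (linear a v) (linear b w) d ↭-refl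

eval-⟨⟩ : ∀ t σ α → ⟦ ⌊ t ⌋ ⟨ σ ⟩ ⟧ α ≡ eval t (λ x → ⟦ σ x ⟧ α)
eval-⟨⟩ (leaf x) σ α = refl
eval-⟨⟩ (a ⊓ b)  σ α = cong₂ Bool._∧_ (eval-⟨⟩ a σ α) (eval-⟨⟩ b σ α)
eval-⟨⟩ (a ⊔ b)  σ α = cong₂ Bool._∨_ (eval-⟨⟩ a σ α) (eval-⟨⟩ b σ α)

eval-⌊⌋ : ∀ t α → ⟦ ⌊ t ⌋ ⟧ α ≡ eval t α
eval-⌊⌋ (leaf x) α = refl
eval-⌊⌋ (a ⊓ b)  α = cong₂ Bool._∧_ (eval-⌊⌋ a α) (eval-⌊⌋ b α)
eval-⌊⌋ (a ⊔ b)  α = cong₂ Bool._∨_ (eval-⌊⌋ a α) (eval-⌊⌋ b α)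

vars-⌊⌋ : ∀ t → vars ⌊ t ⌋ ≡ leaves t
vars-⌊⌋ (leaf x) = refl
vars-⌊⌋ (a ⊓ b)  = cong₂ _++_ (vars-⌊⌋ a) (vars-⌊⌋ b)
vars-⌊⌋ (a ⊔ b)  = cong₂ _++_ (vars-⌊⌋ a) (vars-⌊⌋ b)

-- The two substitutions amount to two assignments that agree off x, one true and the other false at
-- x.
TrivialIn⇒⊨ : ∀ {x a b} → TrivialIn x a b → ⌊ a ⌋ [ ⊤ / x ] ⊨ ⌊ b ⌋ [ ⊥ / x ]
TrivialIn⇒⊨ {x} {a} {b} tr α = ≡.subst₂ _⊑_ (sym (eval-⟨⟩ a _ α)) (sym (eval-⟨⟩ b _ α)) (tr off)
  where
  off : Off x (λ y → ⟦ if does (y ≟ x) then ⊤ else var y ⟧ α)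
              (λ y → ⟦ if does (y ≟ x) then ⊥ else var y ⟧ α)
  off {y} y≢x rewrite dec-false (y ≟ x) y≢x = refl

≃⇒∼ac : ∀ {a b} → a ≃ b → ⌊ a ⌋ ∼ac ⌊ b ⌋
≃⇒∼ac ≃-refl               = ∼-refl
≃⇒∼ac (≃-sym e)            = ∼-sym (≃⇒∼ac e)
≃⇒∼ac (≃-trans e f)        = ∼-trans (≃⇒∼ac e) (≃⇒∼ac f)
≃⇒∼ac (≃-cong conj e f)    = ∧-cong (≃⇒∼ac e) (≃⇒∼ac f)
≃⇒∼ac (≃-cong disj e f)    = ∨-cong (≃⇒∼ac e) (≃⇒∼ac f)
≃⇒∼ac (≃-comm conj a b)    = ∧-comm _ _
≃⇒∼ac (≃-comm disj a b)    = ∨-comm _ _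
≃⇒∼ac (≃-assoc conj a b t) = ∧-assoc _ _ _
≃⇒∼ac (≃-assoc disj a b t) = ∨-assoc _ _ _

-- The substitution that instantiates the variables 0, 1, 2, ... of `switch` and `medial`.
assign : List Tree → ℕ → Formula
assign []       i       = var i
assign (t ∷ ts) zero    = ⌊ t ⌋
assign (t ∷ ts) (suc i) = assign ts i

⊸⇒Step : ∀ {a b} → a ⊸ b → Unique (leaves a) → Step SwitchMedial ⌊ a ⌋ ⌊ b ⌋
⊸⇒Step {a} {b} s u = go s (_ , linear a u) (_ , linear b (Unique-resp-↭ (⊸-leaves s) u))
  where
  go : ∀ {a b} → a ⊸ b → Linear ⌊ a ⌋ → Linear ⌊ b ⌋ → Step SwitchMedial ⌊ a ⌋ ⌊ b ⌋
  go (sw x y z)         l m = subst (assign (x ∷ y ∷ z ∷ [])) (base (inj₁ refl)) l m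
  go (md w x y z)       l m = subst (assign (w ∷ x ∷ y ∷ z ∷ [])) (base (inj₂ refl)) l m
  go (left conj b s) l@(_ , ∧-on la _ _ _) m@(_ , ∧-on ma _ _ _) =
    ∧ˡ _ (go s (_ , la) (_ , ma)) l m
  go (left disj b s) l@(_ , ∨-on la _ _ _) m@(_ , ∨-on ma _ _ _) =
    ∨ˡ _ (go s (_ , la) (_ , ma)) l m
  go (right conj b s) l@(_ , ∧-on _ la _ _) m@(_ , ∧-on _ ma _ _) =
    ∧ʳ _ (go s (_ , la) (_ , ma)) l m
  go (right disj b s) l@(_ , ∨-on _ la _ _) m@(_ , ∨-on _ ma _ _) =
    ∨ʳ _ (go s (_ , la) (_ , ma)) l m

⟶⇒⇝* : ∀ {a b} → a ⟶ b → Unique (leaves a) → ⌊ a ⌋ ⇝*[ SwitchMedial ] ⌊ b ⌋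
⟶⇒⇝* ε            u = ε
⟶⇒⇝* (inj₁ e ◅ r) u = inj₂ (≃⇒∼ac e) ◅ ⟶⇒⇝* r (Unique-resp-↭ (≃-leaves e) u)
⟶⇒⇝* (inj₂ s ◅ r) u =
  inj₁ (_ , _ , ∼-refl , ⊸⇒Step s u , ∼-refl) ◅ ⟶⇒⇝* r (Unique-resp-↭ (⊸-leaves s) u)

inference : ∀ {V} ι {a b} → lhs ι ≡ ⌊ a ⌋ → rhs ι ≡ ⌊ b ⌋ →
  lhs ι LinearOn V → rhs ι LinearOn V → NonTrivial ι → Inference a b
inference ι {a} {b} p q l m nt = record
  { unique     = Unique-resp-↭ V↭a (LinearOn⇒Unique l)
  ; same       = ↭-trans (↭-sym V↭a) (LinearOn⇒↭ b (≡.subst (_LinearOn _) q m))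
  ; entails    = λ α → ≡.subst₂ _⊑_
      (trans (cong (λ φ → ⟦ φ ⟧ α) p) (eval-⌊⌋ a α))
      (trans (cong (λ φ → ⟦ φ ⟧ α) q) (eval-⌊⌋ b α)) (valid ι α)
  ; nontrivial = λ {x} x∈a tr → nt
      (x , ∈-++⁺ˡ (≡.subst (x ∈_) (sym (trans (cong vars p) (vars-⌊⌋ a))) x∈a) ,
       ≡.subst₂ (λ φ ψ → φ [ ⊤ / x ] ⊨ ψ [ ⊥ / x ]) (sym p) (sym q) (TrivialIn⇒⊨ {x} {a} {b} tr))
  }
  where
  V↭a = LinearOn⇒↭ a (≡.subst (_LinearOn _) p l)

-- Evaluation of the check and conclusion

check-7 : check 7 ≡ true
check-7 = refl

-- The list is `downFrom 8`, whose members are exactly the numbers below 8.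
checked : All (λ n → check n ≡ true) (7 ∷ 6 ∷ 5 ∷ 4 ∷ 3 ∷ 2 ∷ 1 ∷ 0 ∷ [])
checked = check-7 ∷ refl ∷ refl ∷ refl ∷ refl ∷ refl ∷ refl ∷ refl ∷ []

theorem2p13 : (n : ℕ) → n < 8 →
    (V : List ℕ) → length V ≡ n →
    (ι : LinearInference) →
    lhs ι LinearOn V → rhs ι LinearOn V →
    ConstantFree (lhs ι) → NegationFree (lhs ι) →
    ConstantFree (rhs ι) → NegationFree (rhs ι) →
    NonTrivial ι →
    lhs ι ⇝*[ SwitchMedial ] rhs ι
theorem2p13 n n<8 V refl ι l m cˡ nˡ cʳ nʳ nt with tree cˡ nˡ | tree cʳ nʳ
... | a , p | b , q = ≡.subst₂ (_⇝*[ SwitchMedial ]_) (sym p) (sym q)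
  (⟶⇒⇝* (below (All.lookup checked ∘ ∈-downFrom⁺) 8 ≤-refl a<8 i) (unique i))
  where
  i = inference ι p q l m nt

  a<8 : size a < 8
  a<8 = ≡.subst (_< 8) (↭-length (LinearOn⇒↭ a (≡.subst (_LinearOn V) p l))) n<8
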